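{- Let $s>t\ge1$ and $r\ge2$ be integers, and set $d=\frac{2s-t-1}{s-t+1}$. If $d$ is an integer and $d\mid r$, then, as $n\to\infty$, $$L_{(s,t)}(n,r)=\Theta\left(n^{r/d}\right)=\Theta\left(n^{(s-t+1)r/(2s-t-1)}\right).$$
   Context: An $r$-uniform hypergraph ($r$-graph) is a family (without repeated members) of $r$-element subsets, called edges, of a finite vertex set. For integers $s\ge t\ge1$, an $r$-graph is called locally $(s,t)$-thin if, among any $s$ distinct edges, at least $t$ of them contain a vertex that belongs to none of the other $s-1$ edges. $L_{(s,t)}(n,r)$ denotes the maximum number of edges in a locally $(s,t)$-thin $r$-graph on $n$ vertices. The parameters $s,t,r$ are fixed, and the constants implied by $\Theta$ may depend on $s,t,r$ only. -}

module Defs where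

open import Data.Bool.Base using (true; false)
import Data.Bool.Properties as Bool
open import Data.Fin.Base using (Fin; zero; suc)
import Data.Fin.Properties as Fin
open import Data.Fin.Subset using (Subset; ∣_∣; _∈_; _∉_)
open import Data.Fin.Subset.Properties using (_∈?_)
open import Data.List.Base using (List; []; _∷_; length; filter; lookup; cartesianProductWith)
open import Data.List.Membership.Propositional using (find; lose) renaming (_∈_ to _∈ˡ_)
open import Data.List.Membership.Propositional.Properties using (∈-cartesianProductWith⁺; ∈-lookup)
open import Data.List.Relation.Binary.Subset.Propositional using (_⊆_)
open import Data.List.Relation.Unary.All as All using (All; []; _∷_; all?)
open import Data.List.Relation.Unary.AllPairs using ([]; _∷_; allPairs?)
open import Data.List.Relation.Unary.Any using (Any; here; there; index; any?)
open import Data.List.Relation.Unary.Any.Properties using (lookup-index)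
open import Data.List.Relation.Unary.Unique.Propositional using (Unique)
open import Data.Nat.Base using (ℕ; zero; suc; _*_; _≤_)
import Data.Nat.Properties as ℕ
open import Data.Product.Base using (∃-syntax; _×_; _,_)
open import Data.Vec.Base using ([]; _∷_)
open import Data.Vec.Properties using (≡-dec)
open import Relation.Binary.Definitions using (DecidableEquality)
open import Relation.Binary.PropositionalEquality using (_≡_; _≢_; refl; sym; trans; cong)
open import Relation.Nullary.Decidable using (yes; no; ¬?; _×-dec_; _→-dec_; map′)
open import Relation.Nullary.Negation using (contradiction)
open import Relation.Unary using (Decidable)

------------------------------------------------------------------------
-- Locally thin hypergraphs

record Hypergraph (n r : ℕ) : Set where
  field
    edges    : List (Subset n)
    distinct : Unique edges
    uniform  : All (λ e → ∣ e ∣ ≡ r) edges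

open Hypergraph public

_≟ₛ_ : ∀ {n} → DecidableEquality (Subset n)
_≟ₛ_ = ≡-dec Bool._≟_

HasOwnVertex : ∀ {n} → List (Subset n) → Subset n → Set
HasOwnVertex S e = ∃[ v ] v ∈ e × All (λ f → f ≢ e → v ∉ f) S

hasOwnVertex? : ∀ {n} (S : List (Subset n)) → Decidable (HasOwnVertex S)
hasOwnVertex? S e = Fin.any? λ v →
  v ∈? e ×-dec all? (λ f → ¬? (f ≟ₛ e) →-dec ¬? (v ∈? f)) S

-- Uniqueness and length of S say "s distinct edges"; the order of S is immaterial.
Thin : ∀ {n} → ℕ → ℕ → List (Subset n) → Set
Thin s t E = ∀ S → Unique S → length S ≡ s → All (_∈ˡ E) S →
  t ≤ length (filter (hasOwnVertex? S) S)

IsThin : ∀ {n r} → ℕ → ℕ → Hypergraph n r → Set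
IsThin s t H = Thin s t (edges H)

ThinOfSize : (s t n r m : ℕ) → Set
ThinOfSize s t n r m = ∃[ H ] IsThin {n} {r} s t H × length (edges H) ≡ m

------------------------------------------------------------------------
-- Finite search

words : ∀ {A : Set} → ℕ → List A → List (List A)
words zero    xs = [] ∷ []
words (suc m) xs = cartesianProductWith _∷_ xs (words m xs)

∈-words : ∀ {A : Set} {xs : List A} ys → All (_∈ˡ xs) ys → ys ∈ˡ words (length ys) xs
∈-words []       []         = here refl
∈-words (y ∷ ys) (y∈ ∷ ys∈) = ∈-cartesianProductWith⁺ _∷_ y∈ (∈-words ys ys∈)

subsets : ∀ n → List (Subset n)
subsets zero    = [] ∷ []
subsets (suc n) = cartesianProductWith _∷_ (true ∷ false ∷ []) (subsets n)

∈-subsets : ∀ {n} (p : Subset n) → p ∈ˡ subsets n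
∈-subsets []          = here refl
∈-subsets (true  ∷ p) = ∈-cartesianProductWith⁺ _∷_ {xs = true ∷ false ∷ []} (here refl) (∈-subsets p)
∈-subsets (false ∷ p) = ∈-cartesianProductWith⁺ _∷_ {xs = true ∷ false ∷ []} (there (here refl)) (∈-subsets p)

unique? : ∀ {n} → Decidable (Unique {A = Subset n})
unique? = allPairs? λ p q → ¬? (p ≟ₛ q)

thin? : ∀ {n} s t → Decidable (Thin {n} s t)
thin? {n} s t E = map′ to from (all? good? (words s E))
  where
  Good : List (Subset n) → Set
  Good S = Unique S → length S ≡ s → All (_∈ˡ E) S →
    t ≤ length (filter (hasOwnVertex? S) S)

  good? : Decidable Good
  good? S = unique? S →-dec (length S ℕ.≟ s →-dec
    (all? (λ e → any? (e ≟ₛ_) E) S →-dec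
      (t ℕ.≤? length (filter (hasOwnVertex? S) S))))

  to : All Good (words s E) → Thin s t E
  to all S uniq refl S⊆E = All.lookup all (∈-words S S⊆E) uniq refl S⊆E

  from : Thin s t E → All Good (words s E)
  from thin = All.tabulate λ {S} _ → thin S

thinOfSize? : ∀ s t n r → Decidable (ThinOfSize s t n r)
thinOfSize? s t n r m = map′ to from (any? good? (words m (subsets n)))
  where
  Good : List (Subset n) → Set
  Good E = Unique E × All (λ e → ∣ e ∣ ≡ r) E × Thin s t E × length E ≡ m

  good? : Decidable Good
  good? E = unique? E ×-dec (all? (λ e → ∣ e ∣ ℕ.≟ r) E ×-dec
    (thin? s t E ×-dec (length E ℕ.≟ m)))

  to : Any Good (words m (subsets n)) → ThinOfSize s t n r m
  to any with E , _ , uniq , unif , thin , len ← find any =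
    record { edges = E ; distinct = uniq ; uniform = unif } , thin , len

  from : ThinOfSize s t n r m → Any Good (words m (subsets n))
  from (H , thin , refl) =
    lose (∈-words (edges H) (All.tabulate λ {e} _ → ∈-subsets e))
         (distinct H , uniform H , thin , refl)

lookup-injective : ∀ {A : Set} {xs : List A} → Unique xs →
  ∀ i j → lookup xs i ≡ lookup xs j → i ≡ j
lookup-injective (_    ∷ _)    zero    zero    _  = refl
lookup-injective (x≢xs ∷ _)    zero    (suc j) eq = contradiction eq (All.lookup x≢xs (∈-lookup j))
lookup-injective (x≢xs ∷ _)    (suc i) zero    eq = contradiction (sym eq) (All.lookup x≢xs (∈-lookup i))
lookup-injective (_    ∷ uniq) (suc i) (suc j) eq = cong suc (lookup-injective uniq i j eq)

Unique-⊆⇒length≤ : ∀ {A : Set} {xs ys : List A} → Unique xs → xs ⊆ ys → length xs ≤ length ys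
Unique-⊆⇒length≤ {A} {xs} {ys} uniq xs⊆ys = Fin.injective⇒≤ {f = pos} pos-injective
  where
  mem : ∀ i → lookup xs i ∈ˡ ys
  mem i = xs⊆ys (∈-lookup i)

  pos : Fin (length xs) → Fin (length ys)
  pos i = index (mem i)

  pos-injective : ∀ {i j} → pos i ≡ pos j → i ≡ j
  pos-injective {i} {j} eq = lookup-injective uniq i j
    (trans (lookup-index (mem i))
      (trans (cong (lookup ys) eq) (sym (lookup-index (mem j)))))

-- The largest m ≤ b satisfying P, or 0 if there is none.
greatest : {P : ℕ → Set} → Decidable P → ℕ → ℕ
greatest P? zero = zero
greatest P? (suc b) with P? (suc b)
... | yes _ = suc b
... | no  _ = greatest P? b

greatest-satisfies : {P : ℕ → Set} (P? : Decidable P) → P 0 → ∀ b → P (greatest P? b)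
greatest-satisfies P? p₀ zero = p₀
greatest-satisfies P? p₀ (suc b) with P? (suc b)
... | yes p = p
... | no  _ = greatest-satisfies P? p₀ b

greatest-upper : {P : ℕ → Set} (P? : Decidable P) → ∀ b {m} → m ≤ b → P m → m ≤ greatest P? b
greatest-upper P? zero m≤0 _ = m≤0
greatest-upper {P} P? (suc b) {m} m≤ p with P? (suc b)
... | yes _ = m≤
... | no ¬p = greatest-upper P? b (ℕ.≤-pred (ℕ.≤∧≢⇒< m≤ λ { refl → ¬p p })) p

------------------------------------------------------------------------
-- The extremal function

L : (s t n r : ℕ) → ℕ
L s t n r = greatest (thinOfSize? s t n r) (length (subsets n))

-- For t ≤ s the edgeless hypergraph is thin, so L is a genuine maximum.
L-attained : ∀ {s t} → t ≤ s → ∀ n r → ThinOfSize s t n r (L s t n r)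
L-attained {s} {t} t≤s n r =
  greatest-satisfies (thinOfSize? s t n r) (none , thin , refl) (length (subsets n))
  where
  none : Hypergraph n r
  none = record { edges = [] ; distinct = [] ; uniform = [] }

  thin : IsThin s t none
  thin []      _ refl _        = t≤s
  thin (_ ∷ _) _ _    (() ∷ _)

L-upper : ∀ s t {n r} (H : Hypergraph n r) → IsThin s t H → length (edges H) ≤ L s t n r
L-upper s t {n} {r} H thin =
  greatest-upper (thinOfSize? s t n r) (length (subsets n))
    (Unique-⊆⇒length≤ (distinct H) λ {e} _ → ∈-subsets e)
    (H , thin , refl)

------------------------------------------------------------------------
-- Asymptotics as n → ∞

-- Natural-number constants lose no generality: a real constant may be
-- rounded up.

infix 4 _∈O_ _∈Θ_

_∈O_ : (f g : ℕ → ℕ) → Set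
f ∈O g = ∃[ c ] ∃[ n₀ ] ∀ n → n₀ ≤ n → f n ≤ c * g n

_∈Θ_ : (f g : ℕ → ℕ) → Set
f ∈Θ g = f ∈O g × g ∈O f

{-# OPTIONS --safe #-}
module Submission where

-- Put u = s − t + 1 and k = r / d, so that d u + 2 = s + u; a hypergraph fails
-- to be thin iff some s of its edges include u that are covered by the others.
--
-- Upper bound.  If every k-subset of every edge lies in at least s edges, cover
-- one edge by d fresh edges, one for each chunk of k vertices, and then u − 1
-- times cover the newest edge, which already shares a chunk with another one,
-- by d − 1 fresh edges.  This gives (d − 1) u + 2 = s edges, u of them covered.
-- So a thin hypergraph always has an edge with a k-subset in fewer than s
-- edges; remove it and repeat.
--
-- Lower bound.  Take edges that are graphs of functions [r] → [q].  For a list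
-- T of functions let c(T) be the sum over the coordinates of |T| minus the
-- number of values attained.  By averaging and deletion there is a family of
-- order q ^ k with c(T) < (|T| − 1) k whenever |T| ∈ {2, u, s}.  If u members
-- of T, forming U, were covered and |T| = s, every coordinate would contribute
-- at least u to c(U) + c(T), so d k u ≤ c(U) + c(T) < (u − 1 + s − 1) k = d u k.

open import Data.Bool.Base using (true; false)
open import Data.Fin.Base using (Fin; zero; suc; _↑ˡ_; _↑ʳ_)
import Data.Fin.Properties as Fin
open import Data.Fin.Subset using (Subset; ∣_∣; _∈_; _∉_; ⁅_⁆)
import Data.Fin.Subset as Subset
open import Data.Fin.Subset.Properties using (_∈?_; x∈⁅x⁆; x∈⁅y⁆⇒x≡y; ∣⁅x⁆∣≡1; ∣⊥∣≡0)
open import Data.List.Base using (List; []; _∷_; [_]; _++_; map; length; filter; take; allFin; tabulate; cartesianProductWith)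
open import Data.List.Properties using (length-map; length-++; length-take; length-drop; take++drop≡id; filter-++; filter-accept; map-tabulate; length-tabulate; map-cong; map-∘; map-++)
open import Data.List.Membership.Propositional using (find; lose) renaming (_∈_ to _∈ˡ_; _∉_ to _∉ˡ_)
open import Data.List.Membership.Propositional.Properties
import Data.List.Membership.DecPropositional as DecMembership
open import Data.List.Relation.Binary.Subset.Propositional using (_⊆_)
open import Data.List.Relation.Binary.Sublist.Propositional using ([]; _∷_; _∷ʳ_; from∈; ⊆-refl; ⊆-trans) renaming (_⊆_ to _⊑_; lookup to ⊑-lookup)
import Data.List.Relation.Binary.Sublist.Propositional.Properties as Sublist
open import Data.List.Relation.Unary.All as All using (All; []; _∷_; all?)
import Data.List.Relation.Unary.All.Properties as All
open import Data.List.Relation.Unary.AllPairs using ([]; _∷_)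
open import Data.List.Relation.Unary.Any using (Any; here; there; any?)
open import Data.List.Relation.Unary.Unique.Propositional using (Unique)
import Data.List.Relation.Unary.Unique.Propositional.Properties as Unique
open import Data.Nat.Base using (ℕ; zero; suc; _+_; _*_; _∸_; _^_; _⊓_; _≤_; _<_; z≤n; s≤s; NonZero; >-nonZero)
open import Data.Nat.DivMod using (_/_; _%_; m≡m%n+[m/n]*n; m%n<n; m*n/n≡m; /-monoˡ-≤; m≥n⇒m/n>0; m/n*n≤m)
open import Data.Nat.Divisibility using (_∣_; quotient; divides)
open import Data.Nat.ListAction using (sum)
open import Data.Nat.ListAction.Properties using (sum-++)
open import Data.Nat.Properties
open import Data.Nat.Tactic.RingSolver using (solve-∀)
open import Data.Product.Base using (∃-syntax; _×_; _,_; proj₁; proj₂; Σ-syntax)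
open import Data.Sum.Base using (_⊎_; inj₁; inj₂; [_,_]′)
open import Data.Vec.Base as Vec using (Vec; []; _∷_)
import Data.Vec.Properties as Vec
open import Function.Base using (_∘_; id; case_of_)
open import Relation.Binary.Definitions using (DecidableEquality)
open import Relation.Binary.PropositionalEquality hiding ([_])
open import Relation.Nullary.Decidable using (Dec; yes; no; ¬?; _×-dec_)
open import Relation.Nullary.Negation using (¬_; contradiction)
open import Relation.Unary using (Decidable)
open import Defs

private variable
  A B C : Set

-- Finite sums and counting in lists.

∑ : List A → (A → ℕ) → ℕ
∑ xs f = sum (map f xs)

∑-cong : ∀ (xs : List A) {f g} → (∀ x → f x ≡ g x) → ∑ xs f ≡ ∑ xs g
∑-cong xs f≗g = cong sum (map-cong f≗g xs)

∑-mono-∈ : ∀ (xs : List A) {f g} → (∀ {x} → x ∈ˡ xs → f x ≤ g x) → ∑ xs f ≤ ∑ xs g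
∑-mono-∈ []       f≤g = z≤n
∑-mono-∈ (x ∷ xs) f≤g = +-mono-≤ (f≤g (here refl)) (∑-mono-∈ xs (f≤g ∘ there))

∑-mono : ∀ (xs : List A) {f g} → (∀ x → f x ≤ g x) → ∑ xs f ≤ ∑ xs g
∑-mono xs f≤g = ∑-mono-∈ xs λ {x} _ → f≤g x

∑-mono-< : ∀ {xs : List A} {f g x} → (∀ y → f y ≤ g y) → x ∈ˡ xs → f x < g x → ∑ xs f < ∑ xs g
∑-mono-< {xs = y ∷ xs} f≤g (here refl) fx<gx = +-mono-<-≤ fx<gx (∑-mono xs f≤g)
∑-mono-< {xs = y ∷ xs} f≤g (there x∈)  fx<gx = +-mono-≤-< (f≤g y) (∑-mono-< f≤g x∈ fx<gx)

∑-const : ∀ (xs : List A) c → ∑ xs (λ _ → c) ≡ length xs * c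
∑-const []       c = refl
∑-const (x ∷ xs) c = cong (c +_) (∑-const xs c)

∑-≤-const : ∀ (xs : List A) {f c} → (∀ x → f x ≤ c) → ∑ xs f ≤ length xs * c
∑-≤-const xs {c = c} f≤c = ≤-trans (∑-mono xs f≤c) (≤-reflexive (∑-const xs c))

∑-+ : ∀ (xs : List A) {f g} → ∑ xs (λ x → f x + g x) ≡ ∑ xs f + ∑ xs g
∑-+ []       = refl
∑-+ (x ∷ xs) {f} {g} = trans (cong (f x + g x +_) (∑-+ xs)) (interchange (f x) (g x) (∑ xs f) (∑ xs g))
  where
  interchange : ∀ a b c d → a + b + (c + d) ≡ a + c + (b + d)
  interchange = solve-∀

∑-*ˡ : ∀ (xs : List A) c {f} → ∑ xs (λ x → c * f x) ≡ c * ∑ xs f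
∑-*ˡ []       c     = sym (*-zeroʳ c)
∑-*ˡ (x ∷ xs) c {f} = trans (cong (c * f x +_) (∑-*ˡ xs c)) (sym (*-distribˡ-+ c (f x) _))

∑-*ʳ : ∀ (xs : List A) c {f} → ∑ xs (λ x → f x * c) ≡ ∑ xs f * c
∑-*ʳ xs c = trans (∑-cong xs λ x → *-comm _ c) (trans (∑-*ˡ xs c) (*-comm c _))

∑-map : ∀ (g : B → A) (ys : List B) f → ∑ (map g ys) f ≡ ∑ ys (f ∘ g)
∑-map g ys f = cong sum (sym (map-∘ ys))

∑-swap : ∀ (xs : List A) (ys : List B) {f : A → B → ℕ} →
  ∑ xs (λ x → ∑ ys (f x)) ≡ ∑ ys (λ y → ∑ xs (λ x → f x y))
∑-swap []       ys = sym (trans (∑-const ys 0) (*-zeroʳ (length ys)))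
∑-swap (x ∷ xs) ys = trans (cong (∑ ys _ +_) (∑-swap xs ys)) (sym (∑-+ ys))

∑-cartesianProductWith : ∀ (g : A → B → C) xs ys f →
  ∑ (cartesianProductWith g xs ys) f ≡ ∑ xs (λ x → ∑ ys (λ y → f (g x y)))
∑-cartesianProductWith g []       ys f = refl
∑-cartesianProductWith g (x ∷ xs) ys f = begin
  sum (map f (map (g x) ys ++ rest))      ≡⟨ cong sum (map-++ f (map (g x) ys) rest) ⟩
  sum (map f (map (g x) ys) ++ map f rest) ≡⟨ sum-++ (map f (map (g x) ys)) (map f rest) ⟩
  ∑ (map (g x) ys) f + ∑ rest f           ≡⟨ cong₂ _+_ (∑-map (g x) ys f) (∑-cartesianProductWith g xs ys f) ⟩
  ∑ ys (f ∘ g x) + ∑ xs (λ x → ∑ ys (λ y → f (g x y))) ∎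
  where
  open ≡-Reasoning
  rest = cartesianProductWith g xs ys

length-cartesianProductWith : ∀ (g : A → B → C) xs ys →
  length (cartesianProductWith g xs ys) ≡ length xs * length ys
length-cartesianProductWith g []       ys = refl
length-cartesianProductWith g (x ∷ xs) ys = trans (length-++ (map (g x) ys))
  (cong₂ _+_ (length-map (g x) ys) (length-cartesianProductWith g xs ys))

length-words : ∀ m (xs : List A) → length (words m xs) ≡ length xs ^ m
length-words zero    xs = refl
length-words (suc m) xs = trans (length-cartesianProductWith _∷_ xs (words m xs))
  (cong (length xs *_) (length-words m xs))

Unique-resp-⊑ : {xs ys : List A} → xs ⊑ ys → Unique ys → Unique xs
Unique-resp-⊑ []         uniq       = uniq
Unique-resp-⊑ (y ∷ʳ τ)   (_ ∷ uniq) = Unique-resp-⊑ τ uniq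
Unique-resp-⊑ (refl ∷ τ) (p ∷ uniq) = Sublist.All-resp-⊆ τ p ∷ Unique-resp-⊑ τ uniq

length-filter-¬? : {P : A → Set} (P? : Decidable P) (xs : List A) →
  length (filter P? xs) + length (filter (¬? ∘ P?) xs) ≡ length xs
length-filter-¬? P? []       = refl
length-filter-¬? P? (x ∷ xs) with P? x
... | yes _ = cong suc (length-filter-¬? P? xs)
... | no  _ = trans (+-suc _ _) (cong suc (length-filter-¬? P? xs))

nonempty : {xs : List A} → 0 < length xs → ∃[ x ] x ∈ˡ xs
nonempty {xs = x ∷ xs} _ = x , here refl

∈-words⇒length : ∀ m {xs : List A} {w} → w ∈ˡ words m xs → length w ≡ m
∈-words⇒length zero         (here refl) = refl
∈-words⇒length (suc m) {xs} w∈
  with _ , _ , _ , w′∈ , refl ← ∈-cartesianProductWith⁻ _∷_ xs (words m xs) w∈ = cong suc (∈-words⇒length m w′∈)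

below-average : ∀ (xs : List A) f {c} → 0 < length xs → ∑ xs f ≤ length xs * c → ∃[ x ] x ∈ˡ xs × f x ≤ c
below-average (x ∷ xs) f {c} _ ∑≤ with f x ≤? c
... | yes fx≤c = x , here refl , fx≤c
below-average (x ∷ []) f {c} _ ∑≤ | no fx≰c =
  contradiction (subst₂ _≤_ (+-identityʳ (f x)) (+-identityʳ c) ∑≤) fx≰c
below-average (x ∷ xs@(_ ∷ _)) f {c} _ ∑≤ | no fx≰c
  with y , y∈ , fy≤c ← below-average xs f (s≤s z≤n)
    (+-cancelˡ-≤ c _ _ (≤-trans (+-monoˡ-≤ (∑ xs f) (<⇒≤ (≰⇒> fx≰c))) ∑≤)) = y , there y∈ , fy≤c

-- The upper bound

vertices : ∀ {n} → Subset n → List (Fin n)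
vertices {n} e = filter (_∈? e) (allFin n)

module _ {n : ℕ} where

  Contains : List (Fin n) → Subset n → Set
  Contains w e = All (_∈ e) w

  contains? : ∀ w → Decidable (Contains w)
  contains? w e = all? (_∈? e) w

  -- Words of length k, repetitions allowed, stand in for the k-subsets of the header: there are
  -- `n ^ k` of them, and `words` enumerates them.
  degree : List (Subset n) → List (Fin n) → ℕ
  degree E w = length (filter (contains? w) E)

  -- A positive form of owning no vertex: the construction supplies the witnesses, and they survive
  -- when `S` grows.
  Covered : List (Subset n) → Subset n → Set
  Covered S e = ∀ {v} → v ∈ e → ∃[ f ] f ∈ˡ S × f ≢ e × v ∈ f

  Covered-mono : ∀ {S S′ e} → S ⊆ S′ → Covered S e → Covered S′ e
  Covered-mono S⊆S′ cov v∈e = case cov v∈e of λ (f , f∈S , rest) → f , S⊆S′ f∈S , rest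

  Covered⇒¬HasOwnVertex : ∀ {S e} → Covered S e → ¬ HasOwnVertex S e
  Covered⇒¬HasOwnVertex cov (v , v∈e , own) with f , f∈S , f≢e , v∈f ← cov v∈e =
    All.lookup own f∈S f≢e v∈f

  open DecMembership (_≟ₛ_ {n}) using () renaming (_∈?_ to _∈ˡ?_)
  open DecMembership (Fin._≟_ {n}) using () renaming (_∈?_ to _∈ᵛ?_)

  -- Otherwise the edges of `E` through `w`, which are distinct, would all lie in `S`, and their
  -- number would be at most `length S`.
  fresh-edge : ∀ {E} S w → Unique E → length S < degree E w →
    ∃[ f ] f ∈ˡ E × Contains w f × f ∉ˡ S
  fresh-edge {E} S w uniq |S|<deg with any? (λ f → ¬? (f ∈ˡ? S)) (filter (contains? w) E)
  ... | yes new = case find new of λ (f , f∈ , f∉S) →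
    case ∈-filter⁻ (contains? w) {xs = E} f∈ of λ (f∈E , w⊆f) → f , f∈E , w⊆f , f∉S
  ... | no ¬new = contradiction |S|<deg (≤⇒≯
    (Unique-⊆⇒length≤ (Unique.filter⁺ (contains? w) uniq) λ {f} f∈ →
      case f ∈ˡ? S of λ where
        (yes f∈S) → f∈S
        (no  f∉S) → contradiction (lose f∈ f∉S) ¬new))

  -- Here and in Peeling, suc d is the d of the theorem and 2 + u the u of the header.
  module Growth (E : List (Subset n)) (E! : Unique E) (d k s : ℕ)
    (uniform : ∀ {e} → e ∈ˡ E → length (vertices e) ≡ suc d * k)
    (saturated : ∀ {e} → e ∈ˡ E → ∀ w → length w ≡ k → Contains w e → s ≤ degree E w)
    where

    -- The shared chunk `w` makes the new edge `f` cheaper to cover later: `e` already covers that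
    -- part of it.
    Linked : List (Subset n) → Subset n → Subset n → Set
    Linked S e f = f ∉ˡ S × ∃[ w ] length w ≡ k × Unique w × Contains w e × Contains w f

    record Attachment (S : List (Subset n)) (e : Subset n) (c : ℕ) (V : List (Fin n)) : Set where
      field
        new    : List (Subset n)
        unique : Unique (new ++ S)
        ⊆E     : new ++ S ⊆ E
        size   : length new ≡ c
        linked : All (Linked S e) new
        covers : All (λ v → Any (v ∈_) new) V

    -- Cut `V` into `c` chunks of length `k` and give each a fresh edge. Whenever one is chosen, the
    -- bound on `c + length S` ensures that fewer than `s` edges are in use, so saturation leaves an
    -- edge outside them.
    attach : ∀ c {S e V} → Unique S → S ⊆ E → c + length S ≤ s → e ∈ˡ S →
      Unique V → length V ≡ c * k → Contains V e → Attachment S e c V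
    attach zero {V = []} S! S⊆E _ _ _ _ _ = record
      { new = [] ; unique = S! ; ⊆E = S⊆E ; size = refl ; linked = [] ; covers = [] }
    attach (suc c) {S} {e} {V} S! S⊆E fits e∈S V! |V| V⊆e = record
      { new    = f ∷ new
      ; unique = All.tabulate (λ g∈ f≡g → f∉ (subst (_∈ˡ new ++ S) (sym f≡g) g∈)) ∷ unique
      ; ⊆E     = λ { (here refl) → f∈E ; (there g∈) → ⊆E g∈ }
      ; size   = cong suc size
      ; linked = (f∉ ∘ ∈-++⁺ʳ new , w , |w| , Unique.take⁺ k V! , w⊆e , w⊆f) ∷ linked
      ; covers = subst (All _) (take++drop≡id k V)
                   (All.++⁺ (All.map here w⊆f) (All.map there covers))
      }
      where
      w = take k V

      |w| : length w ≡ k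
      |w| = trans (length-take k V) (m≤n⇒m⊓n≡m (≤-trans (m≤m+n k (c * k)) (≤-reflexive (sym |V|))))

      w⊆e : Contains w e
      w⊆e = All.take⁺ k V⊆e

      open Attachment (attach c S! S⊆E (<⇒≤ fits) e∈S (Unique.drop⁺ k V!)
        (trans (length-drop k V) (trans (cong (_∸ k) |V|) (m+n∸m≡n k (c * k))))
        (All.drop⁺ k V⊆e))

      found : ∃[ f ] f ∈ˡ E × Contains w f × f ∉ˡ new ++ S
      found = fresh-edge (new ++ S) w E!
        (≤-trans (≤-trans (≤-reflexive (cong suc (trans (length-++ new) (cong (_+ length S) size)))) fits)
          (saturated (S⊆E e∈S) w |w| w⊆e))

      f   = proj₁ found
      f∈E = proj₁ (proj₂ found)
      w⊆f = proj₁ (proj₂ (proj₂ found))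
      f∉  = proj₂ (proj₂ (proj₂ found))

    -- The state after `j` edges have been covered. The first costs `suc d` edges besides itself and
    -- each later one `d`, whence `2 + j * d`.
    record Cluster (j : ℕ) : Set where
      field
        S       : List (Subset n)
        S!      : Unique S
        S⊆E     : S ⊆ E
        |S|     : length S ≡ 2 + j * d
        U       : List (Subset n)
        U!      : Unique U
        U⊆S     : U ⊆ S
        |U|     : length U ≡ j
        covered : All (Covered S) U

    -- The edge to be covered next: `partner` already covers its chunk `w`, so only the other `d`
    -- chunks call for fresh edges.
    record Tip {j} (C : Cluster j) : Set where
      open Cluster C
      field
        tip     : Subset n
        tip∈S   : tip ∈ˡ S
        tip∉U   : tip ∉ˡ U
        w       : List (Fin n)
        |w|     : length w ≡ k
        w!      : Unique w
        w⊆tip   : Contains w tip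
        partner : Subset n
        partner∈S   : partner ∈ˡ S
        partner≢tip : partner ≢ tip
        w⊆partner   : Contains w partner

    vertices! : ∀ e → Unique (vertices e)
    vertices! e = Unique.filter⁺ (_∈? e) (Unique.allFin⁺ n)

    vertices⁺ : ∀ {e : Subset n} {v} → v ∈ e → v ∈ˡ vertices e
    vertices⁺ {e} {v} = ∈-filter⁺ (_∈? e) (∈-allFin v)

    vertices⁻ : ∀ {e : Subset n} → Contains (vertices e) e
    vertices⁻ {e} = All.tabulate λ v∈ → proj₂ (∈-filter⁻ (_∈? e) {xs = allFin n} v∈)

    -- A freshly attached edge can be the next tip: it lies outside `S₀`, hence outside `U`, and the
    -- edge it was attached to is its partner.
    sprout : ∀ {j S U e} (C : Cluster j) → Cluster.S C ≡ S → Cluster.U C ≡ U → ∀ {S₀} →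
      S₀ ⊆ S → U ⊆ S₀ → e ∈ˡ S₀ → ∀ {f} → f ∈ˡ S → Linked S₀ e f → Tip C
    sprout {e = e} C refl refl S₀⊆S U⊆S₀ e∈S₀ {f} f∈S (f∉S₀ , w , |w| , w! , w⊆e , w⊆f) = record
      { tip = f ; tip∈S = f∈S ; tip∉U = f∉S₀ ∘ U⊆S₀
      ; w = w ; |w| = |w| ; w! = w! ; w⊆tip = w⊆f
      ; partner = e ; partner∈S = S₀⊆S e∈S₀ ; partner≢tip = λ { refl → f∉S₀ e∈S₀ }
      ; w⊆partner = w⊆e }

    start : ∀ {e} → e ∈ˡ E → 2 + d ≤ s → Σ[ C ∈ Cluster 1 ] Tip C
    start {e} e∈E fits = cluster , tip
      where
      attachment : Attachment [ e ] e (suc d) (vertices e)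
      attachment = attach (suc d) ([] ∷ []) (λ { (here refl) → e∈E })
        (≤-trans (≤-reflexive (+-comm (suc d) 1)) fits) (here refl)
        (vertices! e) (uniform e∈E) vertices⁻

      open Attachment attachment

      covered : Covered (new ++ [ e ]) e
      covered v∈e with f , f∈new , v∈f ← find (All.lookup covers (vertices⁺ v∈e)) =
        f , ∈-++⁺ˡ f∈new , (λ { refl → proj₁ (All.lookup linked f∈new) (here refl) }) , v∈f

      cluster : Cluster 1
      cluster = record
        { S = new ++ [ e ] ; S! = unique ; S⊆E = ⊆E
        ; |S| = trans (length-++ new) (trans (cong (_+ 1) size) (arith d))
        ; U = [ e ] ; U! = [] ∷ [] ; U⊆S = ∈-++⁺ʳ new ; |U| = refl
        ; covered = covered ∷ [] }
        where
        arith : ∀ d → suc d + 1 ≡ 2 + 1 * d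
        arith = solve-∀

      first : ∃[ f ] f ∈ˡ new
      first = nonempty (≤-trans (s≤s z≤n) (≤-reflexive (sym size)))

      tip : Tip cluster
      tip = sprout cluster refl refl (∈-++⁺ʳ new) id (here refl)
        (∈-++⁺ˡ (proj₂ first)) (All.lookup linked (proj₂ first))

    -- The partner covers `w`, and `d` fresh edges cover the rest of the tip. The next tip is one of
    -- these fresh edges, so it is promised only if `0 < d`.
    expand : ∀ {j} (C : Cluster j) → Tip C → 2 + suc j * d ≤ s →
      Σ[ C′ ∈ Cluster (suc j) ] (0 < d → Tip C′)
    expand {j} C T fits = cluster , λ 0<d → case first 0<d of λ (f , f∈new) →
        sprout cluster refl refl (∈-++⁺ʳ new) tip∷U⊆S tip∈S (∈-++⁺ˡ f∈new) (All.lookup linked f∈new)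
      where
      open Cluster C
      open Tip T

      V = filter (λ v → ¬? (v ∈ᵛ? w)) (vertices tip)

      -- `w` has no repetitions and lies inside `tip`, so exactly `k` vertices are set aside.
      |vertices∩w| : length (filter (_∈ᵛ? w) (vertices tip)) ≡ k
      |vertices∩w| = trans (≤-antisym
        (Unique-⊆⇒length≤ (Unique.filter⁺ (_∈ᵛ? w) (vertices! tip))
          λ v∈ → proj₂ (∈-filter⁻ (_∈ᵛ? w) {xs = vertices tip} v∈))
        (Unique-⊆⇒length≤ w! λ v∈ → ∈-filter⁺ (_∈ᵛ? w) (vertices⁺ (All.lookup w⊆tip v∈)) v∈)) |w|

      |V| : length V ≡ d * k
      |V| = +-cancelˡ-≡ k _ _ (trans (cong (_+ length V) (sym |vertices∩w|))
        (trans (length-filter-¬? (_∈ᵛ? w) (vertices tip)) (uniform (S⊆E tip∈S))))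

      arith : ∀ d j → d + (2 + j * d) ≡ 2 + suc j * d
      arith = solve-∀

      open Attachment (attach d {S} {tip} {V} S! S⊆E
        (≤-trans (≤-reflexive (trans (cong (d +_) |S|) (arith d j))) fits) tip∈S
        (Unique.filter⁺ _ (vertices! tip)) |V|
        (All.filter⁺ (λ v → ¬? (v ∈ᵛ? w)) vertices⁻))

      tip∷U⊆S : tip ∷ U ⊆ S
      tip∷U⊆S (here refl) = tip∈S
      tip∷U⊆S (there e∈U) = U⊆S e∈U

      tip-covered : Covered (new ++ S) tip
      tip-covered {v} v∈tip with v ∈ᵛ? w
      ... | yes v∈w = partner , ∈-++⁺ʳ new partner∈S , partner≢tip , All.lookup w⊆partner v∈w
      ... | no  v∉w with f , f∈new , v∈f ← find (All.lookup covers
                           (∈-filter⁺ (λ v → ¬? (v ∈ᵛ? w)) (vertices⁺ v∈tip) v∉w)) =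
        f , ∈-++⁺ˡ f∈new , (λ { refl → proj₁ (All.lookup linked f∈new) tip∈S }) , v∈f

      cluster : Cluster (suc j)
      cluster = record
        { S = new ++ S ; S! = unique ; S⊆E = ⊆E
        ; |S| = trans (length-++ new) (trans (cong₂ _+_ size |S|) (arith d j))
        ; U = tip ∷ U
        ; U! = All.tabulate (λ e∈U tip≡e → tip∉U (subst (_∈ˡ U) (sym tip≡e) e∈U)) ∷ U!
        ; U⊆S = ∈-++⁺ʳ new ∘ tip∷U⊆S ; |U| = cong suc |U|
        ; covered = tip-covered ∷ All.map (λ {e} → Covered-mono {e = e} (∈-++⁺ʳ new)) covered }

      first : 0 < d → ∃[ f ] f ∈ˡ new
      first 0<d = nonempty (≤-trans 0<d (≤-reflexive (sym size)))

    -- With `d` equal to 0 an expansion leaves no new tip; the disjunction confines that case to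
    -- `start` alone.
    grow : ∀ {e} → e ∈ˡ E → ∀ j → j ≡ 0 ⊎ 0 < d → 2 + suc j * d ≤ s → Σ[ C ∈ Cluster (suc j) ] Tip C
    grow e∈E zero    _          fits = start e∈E (≤-trans (≤-reflexive (cong (2 +_) (sym (*-identityˡ d)))) fits)
    grow e∈E (suc j) (inj₂ 0<d) fits
      with C , T ← grow e∈E j (inj₂ 0<d) (≤-trans (+-monoʳ-≤ 2 (m≤n+m (suc j * d) d)) fits)
      with C′ , T′ ← expand C T fits = C′ , T′ 0<d

    -- The last expansion needs no tip afterwards, so two covered edges are reached even when `d` is
    -- 0.
    many-covered : ∀ {e} → e ∈ˡ E → ∀ j → j ≡ 0 ⊎ 0 < d → 2 + suc (suc j) * d ≡ s → Cluster (2 + j)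
    many-covered e∈E j j≡0⊎0<d fits
      with C , T ← grow e∈E j j≡0⊎0<d (≤-trans (+-monoʳ-≤ 2 (m≤n+m (suc j * d) d)) (≤-reflexive fits)) =
      proj₁ (expand C T (≤-reflexive fits))

  -- By thinness at least `t` edges of `S` have an own vertex, and these are disjoint from the
  -- covered ones.
  covered-bound : ∀ {s t E S U} → Thin s t E → Unique S → length S ≡ s → S ⊆ E →
    Unique U → U ⊆ S → All (Covered S) U → t + length U ≤ s
  covered-bound {t = t} {S = S} {U} thin S! refl S⊆E U! U⊆S covered = begin
    t + length U          ≤⟨ +-monoˡ-≤ (length U) (thin S S! refl (All.tabulate S⊆E)) ⟩
    length own + length U ≡⟨ length-++ own ⟨
    length (own ++ U)     ≤⟨ Unique-⊆⇒length≤ (Unique.++⁺ (Unique.filter⁺ (hasOwnVertex? S) S!) U! disjoint) own++U⊆S ⟩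
    length S              ∎
    where
    open ≤-Reasoning
    own = filter (hasOwnVertex? S) S

    disjoint : ∀ {e} → ¬ (e ∈ˡ own × e ∈ˡ U)
    disjoint {e} (e∈own , e∈U) = Covered⇒¬HasOwnVertex (All.lookup covered e∈U)
      (proj₂ (∈-filter⁻ (hasOwnVertex? S) {xs = S} e∈own))

    own++U⊆S : own ++ U ⊆ S
    own++U⊆S e∈ = [ (λ e∈own → proj₁ (∈-filter⁻ (hasOwnVertex? S) e∈own)) , U⊆S ]′ (∈-++⁻ own e∈)

  Thin-antimono : ∀ {s t} {E E′ : List (Subset n)} → E′ ⊆ E → Thin s t E → Thin s t E′
  Thin-antimono E′⊆E thin S S! |S| S⊆E′ = thin S S! |S| (All.map E′⊆E S⊆E′)

  -- Removing light edges one at a time.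

  module Peeling (s t d k u : ℕ) (u≡0⊎0<d : u ≡ 0 ⊎ 0 < d)
    (s≡ : 2 + (2 + u) * d ≡ s) (t+u≡ : t + (2 + u) ≡ suc s) where

    -- If the search fails, `E` is saturated and contains `s` edges of which `2 + u` are covered,
    -- whence `t + (2 + u) ≤ s`, contrary to `t+u≡`.
    light : ∀ {E e} → Unique E → All (λ e → length (vertices e) ≡ suc d * k) E → Thin s t E → e ∈ˡ E →
      ∃[ e ] e ∈ˡ E × ∃[ w ] w ∈ˡ words k (allFin n) × Contains w e × degree E w < s
    light {E} E! uniform thin e∈E
      with any? (λ e → any? (λ w → contains? w e ×-dec (degree E w <? s)) (words k (allFin n))) E
    ... | yes found = case find found of λ (e , e∈ , found′) → case find found′ of λ (w , w∈ , w⊆e , deg<s) →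
      e , e∈ , w , w∈ , w⊆e , deg<s
    ... | no ¬found = contradiction
          (≤-trans (≤-reflexive (cong (t +_) (sym |U|))) (covered-bound thin S! (trans |S| s≡) S⊆E U! U⊆S covered))
          (<⇒≱ (≤-reflexive (sym t+u≡)))
      where
      saturated : ∀ {e} → e ∈ˡ E → ∀ w → length w ≡ k → Contains w e → s ≤ degree E w
      saturated e∈ w refl w⊆e = ≮⇒≥ λ deg<s →
        ¬found (lose e∈ (lose (∈-words w (All.tabulate λ {v} _ → ∈-allFin v)) (w⊆e , deg<s)))

      open Growth E E! d k s (All.lookup uniform) saturated
      open Cluster (many-covered e∈E u u≡0⊎0<d s≡)

    -- Each word is charged by fewer than s of the removed edges.
    capped : List (Subset n) → ℕ
    capped E = ∑ (words k (allFin n)) λ w → degree E w ⊓ s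

    degree-++ : ∀ A B w → degree (A ++ B) w ≡ degree A w + degree B w
    degree-++ A B w = trans (cong length (filter-++ (contains? w) A B)) (length-++ (filter (contains? w) A))

    degree-∷ : ∀ e B w → degree B w ≤ degree (e ∷ B) w
    degree-∷ e B w with contains? w e
    ... | yes _ = n≤1+n _
    ... | no  _ = ≤-refl

    -- Removing the light edge `e` lowers the sum by at least one: no other term grows, and at `w`
    -- the degree drops by one while the cap `s` is inactive.
    length≤capped : ∀ m {E} → length E ≡ m → Unique E →
      All (λ e → length (vertices e) ≡ suc d * k) E → Thin s t E → m ≤ capped E
    length≤capped zero    _ _ _ _ = z≤n
    length≤capped (suc m) {E@(_ ∷ _)} |E| E! uniform thin
      with e , e∈E , w , w∈ , w⊆e , deg<s ← light E! uniform thin (here refl)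
      with A , B , E≡ ← ∈-∃++ e∈E = ≤-trans (s≤s (length≤capped m
            (suc-injective (trans (sym (trans (cong length E≡) (trans (length-++ A) (trans (+-suc _ _) (cong suc (sym (length-++ A))))))) |E|))
            (Unique-resp-⊑ A++B⊑E E!) (Sublist.All-resp-⊆ A++B⊑E uniform) (Thin-antimono (⊑-lookup A++B⊑E) thin)))
          (∑-mono-< (λ w → ⊓-monoˡ-≤ s (degree-mono w)) w∈ strict)
      where
      A++B⊑E : A ++ B ⊑ E
      A++B⊑E = subst (A ++ B ⊑_) (sym E≡) (Sublist.++⁺ (⊆-refl {x = A}) (e ∷ʳ ⊆-refl))

      degree-mono : ∀ w → degree (A ++ B) w ≤ degree E w
      degree-mono w = begin
        degree (A ++ B) w             ≡⟨ degree-++ A B w ⟩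
        degree A w + degree B w       ≤⟨ +-monoʳ-≤ (degree A w) (degree-∷ e B w) ⟩
        degree A w + degree (e ∷ B) w ≡⟨ degree-++ A (e ∷ B) w ⟨
        degree (A ++ e ∷ B) w         ≡⟨ cong (λ E → degree E w) E≡ ⟨
        degree E w                    ∎
        where open ≤-Reasoning

      degree-drops : degree E w ≡ suc (degree (A ++ B) w)
      degree-drops = begin
        degree E w                    ≡⟨ cong (λ E → degree E w) E≡ ⟩
        degree (A ++ e ∷ B) w         ≡⟨ degree-++ A (e ∷ B) w ⟩
        degree A w + degree (e ∷ B) w ≡⟨ cong (λ es → degree A w + length es) (filter-accept (contains? w) w⊆e) ⟩
        degree A w + suc (degree B w) ≡⟨ +-suc _ _ ⟩
        suc (degree A w + degree B w) ≡⟨ cong suc (degree-++ A B w) ⟨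
        suc (degree (A ++ B) w)       ∎
        where open ≡-Reasoning

      strict : degree (A ++ B) w ⊓ s < degree E w ⊓ s
      strict = begin-strict
        degree (A ++ B) w ⊓ s ≤⟨ m⊓n≤m _ s ⟩
        degree (A ++ B) w     <⟨ ≤-reflexive (sym degree-drops) ⟩
        degree E w            ≡⟨ m≤n⇒m⊓n≡m (<⇒≤ deg<s) ⟨
        degree E w ⊓ s        ∎
        where open ≤-Reasoning

    length≤s*n^k : ∀ {E} → Unique E → All (λ e → length (vertices e) ≡ suc d * k) E → Thin s t E → length E ≤ s * n ^ k
    length≤s*n^k {E} E! uniform thin = begin
      length E                          ≤⟨ length≤capped (length E) refl E! uniform thin ⟩
      capped E                          ≤⟨ ∑-≤-const (words k (allFin n)) (λ w → m⊓n≤n (degree E w) s) ⟩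
      length (words k (allFin n)) * s   ≡⟨ cong (_* s) (trans (length-words k (allFin n)) (cong (_^ k) (length-tabulate {n = n} id))) ⟩
      n ^ k * s                         ≡⟨ *-comm (n ^ k) s ⟩
      s * n ^ k                         ∎
      where open ≤-Reasoning

vertices-∷ : ∀ {n} b (p : Subset n) → length (filter (_∈? (b ∷ p)) (tabulate suc)) ≡ length (vertices p)
vertices-∷ {n} b p = trans (cong (length ∘ filter (_∈? (b ∷ p))) (sym (map-tabulate id suc))) (go (allFin n))
  where
  go : ∀ vs → length (filter (_∈? (b ∷ p)) (map suc vs)) ≡ length (filter (_∈? p) vs)
  go []       = refl
  go (v ∷ vs) with v ∈? p
  ... | yes _ = cong suc (go vs)
  ... | no  _ = go vs

length-vertices : ∀ {n} (p : Subset n) → length (vertices p) ≡ ∣ p ∣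
length-vertices []          = refl
length-vertices (true  ∷ p) = cong suc (trans (vertices-∷ true p) (length-vertices p))
length-vertices (false ∷ p) = trans (vertices-∷ false p) (length-vertices p)

-- The lower bound

-- The sum of `b` over all choices of `m` positions; for an indicator `b`, the number of bad
-- choices.
occurrences : ℕ → (List A → ℕ) → List A → ℕ
occurrences zero    b w       = b []
occurrences (suc m) b []      = 0
occurrences (suc m) b (x ∷ w) = occurrences (suc m) b w + occurrences m (b ∘ (x ∷_)) w

≤-occurrences : ∀ (b : List A → ℕ) {v w} → v ⊑ w → b v ≤ occurrences (length v) b w
≤-occurrences b {[]}    τ          = ≤-refl
≤-occurrences b {x ∷ v} (y ∷ʳ τ)   = ≤-trans (≤-occurrences b τ) (m≤m+n _ _)
≤-occurrences b {x ∷ v} (refl ∷ τ) = ≤-trans (≤-occurrences (b ∘ (x ∷_)) τ) (m≤n+m _ _)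

occurrences-mono : ∀ m (b : List A → ℕ) {v w} → v ⊑ w → occurrences m b v ≤ occurrences m b w
occurrences-mono zero    b τ          = ≤-refl
occurrences-mono (suc m) b []         = ≤-refl
occurrences-mono (suc m) b (y ∷ʳ τ)   = ≤-trans (occurrences-mono (suc m) b τ) (m≤m+n _ _)
occurrences-mono (suc m) b (refl ∷ τ) = +-mono-≤ (occurrences-mono (suc m) b τ) (occurrences-mono m _ τ)

-- A letter is dropped when it starts a bad subsequence of the original word. It is paid for by an
-- occurrence with that first position, and different letters are paid for by different occurrences.
prune : ∀ m (b : List A → ℕ) w → ∃[ v ] v ⊑ w × occurrences (suc m) b v ≡ 0 ×
  length w ≤ length v + occurrences (suc m) b w
prune m b []      = [] , [] , refl , z≤n
prune m b (x ∷ w) with v , v⊑w , none , few ← prune m b w | occurrences m (b ∘ (x ∷_)) w in eq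
... | zero  = x ∷ v , refl ∷ v⊑w
            , cong₂ _+_ none (n≤0⇒n≡0 (≤-trans (occurrences-mono m _ v⊑w) (≤-reflexive eq)))
            , s≤s (≤-trans few (≤-reflexive (cong (length v +_) (sym (+-identityʳ _)))))
... | suc c = v , x ∷ʳ v⊑w , none
            , ≤-trans (s≤s few) (≤-trans (≤-reflexive (sym (+-suc (length v) _)))
                (+-monoʳ-≤ (length v) (≤-trans (≤-reflexive (sym (+-comm _ 1))) (+-monoʳ-≤ _ (s≤s z≤n)))))

-- Prune for the three weights in turn. `occurrences-mono` keeps the earlier counts at zero and
-- bounds the later losses by the counts in `w` itself.
prune₃ : ∀ l m n (a b c : List A → ℕ) w → ∃[ v ] v ⊑ w ×
  (occurrences (suc l) a v ≡ 0 × occurrences (suc m) b v ≡ 0 × occurrences (suc n) c v ≡ 0) ×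
  length w ≤ length v + (occurrences (suc l) a w + occurrences (suc m) b w + occurrences (suc n) c w)
prune₃ l m n a b c w
  with w₁ , w₁⊑w  , none₁ , few₁ ← prune l a w
  with w₂ , w₂⊑w₁ , none₂ , few₂ ← prune m b w₁
  with w₃ , w₃⊑w₂ , none₃ , few₃ ← prune n c w₂
  = w₃ , ⊆-trans w₃⊑w₂ (⊆-trans w₂⊑w₁ w₁⊑w) , (none l a (⊆-trans w₃⊑w₂ w₂⊑w₁) none₁ , none m b w₃⊑w₂ none₂ , none₃) , (begin
    length w                             ≤⟨ few₁ ⟩
    length w₁ + α                        ≤⟨ +-monoˡ-≤ α few₂ ⟩
    length w₂ + β′ + α                   ≤⟨ +-monoˡ-≤ α (+-mono-≤ few₃ (occurrences-mono (suc m) b w₁⊑w)) ⟩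
    length w₃ + γ′ + β + α               ≤⟨ +-monoˡ-≤ α (+-monoˡ-≤ β (+-monoʳ-≤ (length w₃)
                                              (occurrences-mono (suc n) c (⊆-trans w₂⊑w₁ w₁⊑w)))) ⟩
    length w₃ + γ + β + α                ≡⟨ arith (length w₃) α β γ ⟩
    length w₃ + (α + β + γ)              ∎)
  where
  open ≤-Reasoning
  α = occurrences (suc l) a w
  β = occurrences (suc m) b w
  γ = occurrences (suc n) c w
  β′ = occurrences (suc m) b w₁
  γ′ = occurrences (suc n) c w₂

  none : ∀ m b {v v′} → v′ ⊑ v → occurrences (suc m) b v ≡ 0 → occurrences (suc m) b v′ ≡ 0
  none m b v′⊑v eq = n≤0⇒n≡0 (≤-trans (occurrences-mono (suc m) b v′⊑v) (≤-reflexive eq))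

  arith : ∀ t a b c → t + c + b + a ≡ t + (a + b + c)
  arith = solve-∀

∑-words-suc : ∀ m (xs : List A) f → ∑ (words (suc m) xs) f ≡ ∑ xs (λ x → ∑ (words m xs) (f ∘ (x ∷_)))
∑-words-suc m xs f = ∑-cartesianProductWith _∷_ xs (words m xs) f

-- The number of m-element index sets is bounded by M ^ m.
∑-occurrences : ∀ (xs : List A) M m b →
  ∑ (words M xs) (occurrences m b) * length xs ^ m ≤ M ^ m * ∑ (words m xs) b * length xs ^ M
∑-occurrences xs M zero b = ≤-reflexive (begin
  ∑ (words M xs) (λ _ → b []) * 1 ≡⟨ *-identityʳ _ ⟩
  ∑ (words M xs) (λ _ → b [])     ≡⟨ ∑-const (words M xs) (b []) ⟩
  length (words M xs) * b []      ≡⟨ cong (_* b []) (length-words M xs) ⟩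
  length xs ^ M * b []            ≡⟨ arith (length xs ^ M) (b []) ⟩
  1 * (b [] + 0) * length xs ^ M  ∎)
  where
  open ≡-Reasoning
  arith : ∀ x y → x * y ≡ 1 * (y + 0) * x
  arith = solve-∀
∑-occurrences xs zero (suc m) b = z≤n
∑-occurrences xs (suc M) (suc m) b = begin
  ∑ (words (suc M) xs) (occurrences (suc m) b) * (N * N ^ m)
    ≡⟨ cong (_* (N * N ^ m)) (trans (∑-words-suc M xs _) (trans (∑-cong xs λ x → ∑-+ (words M xs)) (∑-+ xs))) ⟩
  (∑ xs (λ _ → old) + ∑ xs new) * (N * N ^ m)
    ≡⟨ cong (λ z → (z + ∑ xs new) * (N * N ^ m)) (∑-const xs old) ⟩
  (N * old + ∑ xs new) * (N * N ^ m)
    ≡⟨ arith₁ N old (∑ xs new) (N ^ m) ⟩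
  N * (old * (N * N ^ m)) + N * (∑ xs new * N ^ m)
    ≡⟨ cong (λ z → N * (old * (N * N ^ m)) + N * z) (∑-*ʳ xs (N ^ m)) ⟨
  N * (old * (N * N ^ m)) + N * ∑ xs (λ x → new x * N ^ m)
    ≤⟨ +-mono-≤ (*-monoʳ-≤ N (∑-occurrences xs M (suc m) b))
                (*-monoʳ-≤ N (∑-mono xs λ x → ∑-occurrences xs M m (b ∘ (x ∷_)))) ⟩
  N * (M ^ suc m * K * N ^ M) + N * ∑ xs (λ x → M ^ m * ∑ (words m xs) (b ∘ (x ∷_)) * N ^ M)
    ≡⟨ cong (λ z → N * (M ^ suc m * K * N ^ M) + N * z)
         (trans (∑-*ʳ xs (N ^ M)) (cong (_* N ^ M)
           (trans (∑-*ˡ xs (M ^ m)) (cong (M ^ m *_) (sym (∑-words-suc m xs b)))))) ⟩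
  -- Pascal's rule with powers in place of binomial coefficients: `M ^ suc m + M ^ m = suc M * M ^ m
  -- ≤ suc M ^ suc m`.
  N * (M ^ suc m * K * N ^ M) + N * (M ^ m * K * N ^ M)
    ≡⟨ arith₂ N M (M ^ m) K (N ^ M) ⟩
  suc M * M ^ m * K * (N * N ^ M)
    ≤⟨ *-monoˡ-≤ (N * N ^ M) (*-monoˡ-≤ K (*-monoʳ-≤ (suc M) (^-monoˡ-≤ m (n≤1+n M)))) ⟩
  suc M ^ suc m * K * N ^ suc M ∎
  where
  open ≤-Reasoning
  N = length xs
  K = ∑ (words (suc m) xs) b
  old = ∑ (words M xs) (occurrences (suc m) b)

  new : _ → ℕ
  new x = ∑ (words M xs) (occurrences m (b ∘ (x ∷_)))

  arith₁ : ∀ a b c d → (a * b + c) * (a * d) ≡ a * (b * (a * d)) + a * (c * d)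
  arith₁ = solve-∀
  arith₂ : ∀ n m p k q → n * (m * p * k * q) + n * (p * k * q) ≡ suc m * p * k * (n * q)
  arith₂ = solve-∀

-- Repeated values in a list.

indicator : {P : Set} → Dec P → ℕ
indicator (yes _) = 1
indicator (no  _) = 0

∑-indicator : {P : A → Set} (P? : Decidable P) (xs : List A) → ∑ xs (indicator ∘ P?) ≡ length (filter P? xs)
∑-indicator P? []       = refl
∑-indicator P? (x ∷ xs) with P? x
... | yes _ = cong suc (∑-indicator P? xs)
... | no  _ = ∑-indicator P? xs

module Rank {A : Set} (_≟_ : DecidableEquality A) where

  open DecMembership _≟_ using () renaming (_∈?_ to _∈ˡ?_)

  repeats : List A → List A
  repeats []       = []
  repeats (x ∷ xs) with x ∈ˡ? xs
  ... | yes _ = x ∷ repeats xs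
  ... | no  _ = repeats xs

  -- By `distinct-values` this is the length minus the number of values attained, which is what one
  -- coordinate contributes to c(T).
  rank : List A → ℕ
  rank xs = length (repeats xs)

  rank-∷ : ∀ x xs → rank (x ∷ xs) ≡ indicator (x ∈ˡ? xs) + rank xs
  rank-∷ x xs with x ∈ˡ? xs
  ... | yes _ = refl
  ... | no  _ = refl

  repeats-∷⁺ : ∀ {y} x xs → y ∈ˡ repeats xs → y ∈ˡ repeats (x ∷ xs)
  repeats-∷⁺ x xs y∈ with x ∈ˡ? xs
  ... | yes _ = there y∈
  ... | no  _ = y∈

  repeats-here : ∀ {x xs} → x ∈ˡ xs → x ∈ˡ repeats (x ∷ xs)
  repeats-here {x} {xs} x∈ with x ∈ˡ? xs
  ... | yes _  = here refl
  ... | no  x∉ = contradiction x∈ x∉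

  distinct-values : ∀ xs → ∃[ V ] Unique V × V ⊆ xs × length xs ≡ rank xs + length V
  distinct-values []       = [] , [] , (λ ()) , refl
  distinct-values (x ∷ xs) with V , V! , V⊆xs , |xs| ← distinct-values xs | x ∈ˡ? xs
  ... | yes _ = V , V! , there ∘ V⊆xs , cong suc |xs|
  ... | no x∉ = x ∷ V
              , All.tabulate (λ v∈ x≡v → x∉ (V⊆xs (subst (_∈ˡ V) (sym x≡v) v∈))) ∷ V!
              , (λ { (here refl) → here refl ; (there v∈) → there (V⊆xs v∈) })
              , trans (cong suc |xs|) (sym (+-suc _ _))

  -- Whichever of `x` and `y` stands first in `T` meets the common value again later.
  collision⇒repeats : ∀ {κ : B → A} {x y T} → x ∈ˡ T → y ∈ˡ T → x ≢ y → κ x ≡ κ y → κ x ∈ˡ repeats (map κ T)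
  collision⇒repeats         (here refl) (here refl) x≢y _  = contradiction refl x≢y
  collision⇒repeats {κ = κ} {T = _ ∷ T} (here refl) (there y∈) _ eq =
    repeats-here (subst (_∈ˡ map κ T) (sym eq) (∈-map⁺ κ y∈))
  collision⇒repeats {κ = κ} {T = y ∷ T} (there x∈) (here refl) _ eq =
    subst (_∈ˡ repeats (map κ (y ∷ T))) (sym eq) (repeats-here (subst (_∈ˡ map κ T) eq (∈-map⁺ κ x∈)))
  collision⇒repeats {κ = κ} {T = z ∷ T} (there x∈) (there y∈) x≢y eq =
    repeats-∷⁺ (κ z) (map κ T) (collision⇒repeats x∈ y∈ x≢y eq)

  -- Each value taken on U is repeated in T, and U takes length U ∸ rank values.
  length≤rank+rank : ∀ (κ : B → A) U T → (∀ {x} → x ∈ˡ U → κ x ∈ˡ repeats (map κ T)) →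
    length U ≤ rank (map κ U) + rank (map κ T)
  length≤rank+rank κ U T repeated with V , V! , V⊆ , |U| ← distinct-values (map κ U) = begin
    length U                        ≡⟨ length-map κ U ⟨
    length (map κ U)                ≡⟨ |U| ⟩
    rank (map κ U) + length V       ≤⟨ +-monoʳ-≤ (rank (map κ U)) (Unique-⊆⇒length≤ V! V⊆repeats) ⟩
    rank (map κ U) + rank (map κ T) ∎
    where
    open ≤-Reasoning
    V⊆repeats : V ⊆ repeats (map κ T)
    V⊆repeats v∈ with x , x∈ , refl ← ∈-map⁻ κ (V⊆ v∈) = repeated x∈

∑-allFin-suc : ∀ {n} (f : Fin (suc n) → ℕ) → ∑ (allFin (suc n)) f ≡ f zero + ∑ (allFin n) (f ∘ suc)
∑-allFin-suc {n} f = cong (f zero +_) (trans (cong (λ is → ∑ is f) (sym (map-tabulate id suc))) (∑-map suc (allFin n) f))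

length-allFin : ∀ n → length (allFin n) ≡ n
length-allFin n = length-tabulate {n = n} id

-- Collisions among tuples and their generating function.

module Tuples (q : ℕ) where

  open Rank (Fin._≟_ {q}) public
  open DecMembership (Fin._≟_ {q}) using () renaming (_∈?_ to _∈ᶠ?_)

  tuples : ∀ r → List (Vec (Fin q) r)
  tuples zero    = [] ∷ []
  tuples (suc r) = cartesianProductWith _∷_ (allFin q) (tuples r)

  length-tuples : ∀ r → length (tuples r) ≡ q ^ r
  length-tuples zero    = refl
  length-tuples (suc r) = trans (length-cartesianProductWith _∷_ (allFin q) (tuples r))
    (cong₂ _*_ (length-allFin q) (length-tuples r))

  column : ∀ {r} → Fin r → List (Vec (Fin q) r) → List (Fin q)
  column i = map (λ x → Vec.lookup x i)

  collisions : ∀ {r} → List (Vec (Fin q) r) → ℕ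
  collisions {r} T = ∑ (allFin r) λ i → rank (column i T)

  -- The index m is one less than the number of tuples.
  Sparse : ∀ {r} → ℕ → ℕ → List (Vec (Fin q) r) → Set
  Sparse k m T = ∀ {U} → U ⊑ T → length U ≡ suc m → collisions U < m * k

  hits : ∀ {r} → (Fin r → List (Fin q)) → Vec (Fin q) r → ℕ
  hits {r} C x = ∑ (allFin r) λ i → indicator (Vec.lookup x i ∈ᶠ? C i)

  collisions-∷ : ∀ {r} (x : Vec (Fin q) r) T → collisions (x ∷ T) ≡ hits (λ i → column i T) x + collisions T
  collisions-∷ {r} x T = trans (∑-cong (allFin r) λ i → rank-∷ _ (column i T)) (∑-+ (allFin r))

  -- At most `length C` values `a` have weight `q` and the others weight 1, so the total is at most
  -- `q + length C * q`.
  hits-generating-column : ∀ C → ∑ (allFin q) (λ a → q ^ indicator (a ∈ᶠ? C)) ≤ suc (length C) * q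
  hits-generating-column C = begin
    ∑ (allFin q) (λ a → q ^ indicator (a ∈ᶠ? C))        ≤⟨ ∑-mono (allFin q) (λ a → power (a ∈ᶠ? C)) ⟩
    ∑ (allFin q) (λ a → 1 + indicator (a ∈ᶠ? C) * q)    ≡⟨ ∑-+ (allFin q) ⟩
    ∑ (allFin q) (λ _ → 1) + ∑ (allFin q) (λ a → indicator (a ∈ᶠ? C) * q)
      ≡⟨ cong₂ _+_ (trans (∑-const (allFin q) 1) (trans (*-identityʳ _) (length-allFin q))) (∑-*ʳ (allFin q) q) ⟩
    q + ∑ (allFin q) (λ a → indicator (a ∈ᶠ? C)) * q    ≡⟨ cong (λ z → q + z * q) (∑-indicator (_∈ᶠ? C) (allFin q)) ⟩
    q + length (filter (_∈ᶠ? C) (allFin q)) * q         ≤⟨ +-monoʳ-≤ q (*-monoˡ-≤ q (Unique-⊆⇒length≤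
        (Unique.filter⁺ (_∈ᶠ? C) (Unique.allFin⁺ q)) λ a∈ → proj₂ (∈-filter⁻ (_∈ᶠ? C) {xs = allFin q} a∈))) ⟩
    suc (length C) * q                                  ∎
    where
    open ≤-Reasoning
    power : ∀ {P : Set} (P? : Dec P) → q ^ indicator P? ≤ 1 + indicator P? * q
    power (yes _) = ≤-trans (≤-reflexive (*-comm q 1)) (n≤1+n _)
    power (no _)  = ≤-refl

  -- The coordinates of a random tuple are independent, so the sum factors over them.
  hits-generating : ∀ r s (C : Fin r → List (Fin q)) → (∀ i → length (C i) < s) →
    ∑ (tuples r) (λ x → q ^ hits C x) ≤ (s * q) ^ r
  hits-generating zero    s C |C|<s = ≤-refl
  hits-generating (suc r) s C |C|<s = begin
    ∑ (tuples (suc r)) (λ x → q ^ hits C x)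
      ≡⟨ ∑-cartesianProductWith _∷_ (allFin q) (tuples r) _ ⟩
    ∑ (allFin q) (λ a → ∑ (tuples r) (λ x → q ^ hits C (a ∷ x)))
      ≡⟨ ∑-cong (allFin q) (λ a → ∑-cong (tuples r) λ x → trans
           (cong (q ^_) (∑-allFin-suc (λ i → indicator (Vec.lookup (a ∷ x) i ∈ᶠ? C i))))
           (^-distribˡ-+-* q (indicator (a ∈ᶠ? C zero)) (hits (C ∘ suc) x))) ⟩
    ∑ (allFin q) (λ a → ∑ (tuples r) (λ x → q ^ indicator (a ∈ᶠ? C zero) * q ^ hits (C ∘ suc) x))
      ≡⟨ ∑-cong (allFin q) (λ a → ∑-*ˡ (tuples r) (q ^ indicator (a ∈ᶠ? C zero))) ⟩
    ∑ (allFin q) (λ a → q ^ indicator (a ∈ᶠ? C zero) * ∑ (tuples r) (λ x → q ^ hits (C ∘ suc) x))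
      ≡⟨ ∑-*ʳ (allFin q) _ ⟩
    ∑ (allFin q) (λ a → q ^ indicator (a ∈ᶠ? C zero)) * ∑ (tuples r) (λ x → q ^ hits (C ∘ suc) x)
      ≤⟨ *-mono-≤ (≤-trans (hits-generating-column (C zero)) (*-monoˡ-≤ q (|C|<s zero)))
                  (hits-generating r s (C ∘ suc) (|C|<s ∘ suc)) ⟩
    (s * q) ^ suc r ∎
    where open ≤-Reasoning

  -- An exponential moment with base `q`: prefixing a tuple multiplies the total by at most
  -- `(s * q) ^ r`, since the columns it can hit have fewer than `s` entries.
  collisions-generating : ∀ r s m → m ≤ s →
    ∑ (words m (tuples r)) (λ T → q ^ collisions T) ≤ ((s * q) ^ r) ^ m
  collisions-generating r s zero    _   = ≤-reflexive (cong (λ c → q ^ c + 0)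
    (trans (∑-const (allFin r) 0) (*-zeroʳ (length (allFin r)))))
  collisions-generating r s (suc m) m<s = begin
    ∑ (words (suc m) X) (λ T → q ^ collisions T)
      ≡⟨ ∑-words-suc m X _ ⟩
    ∑ X (λ x → ∑ (words m X) (λ T → q ^ collisions (x ∷ T)))
      -- `T` is fixed first, because the new tuple `x` is charged for hitting the columns of `T`.
      ≡⟨ ∑-swap X (words m X) ⟩
    ∑ (words m X) (λ T → ∑ X (λ x → q ^ collisions (x ∷ T)))
      ≡⟨ ∑-cong (words m X) (λ T → ∑-cong X λ x → trans (cong (q ^_) (collisions-∷ x T))
           (^-distribˡ-+-* q (hits (λ i → column i T) x) (collisions T))) ⟩
    ∑ (words m X) (λ T → ∑ X (λ x → q ^ hits (λ i → column i T) x * q ^ collisions T))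
      ≡⟨ ∑-cong (words m X) (λ T → ∑-*ʳ X (q ^ collisions T)) ⟩
    ∑ (words m X) (λ T → ∑ X (λ x → q ^ hits (λ i → column i T) x) * q ^ collisions T)
      ≤⟨ ∑-mono-∈ (words m X) (λ {T} T∈ → *-monoˡ-≤ (q ^ collisions T)
           (hits-generating r s (λ i → column i T) λ i →
             ≤-trans (s≤s (≤-reflexive (trans (length-map _ T) (∈-words⇒length m T∈)))) m<s)) ⟩
    ∑ (words m X) (λ T → (s * q) ^ r * q ^ collisions T)
      ≡⟨ ∑-*ˡ (words m X) ((s * q) ^ r) ⟩
    (s * q) ^ r * ∑ (words m X) (λ T → q ^ collisions T)
      ≤⟨ *-monoʳ-≤ ((s * q) ^ r) (collisions-generating r s m (<⇒≤ m<s)) ⟩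
    ((s * q) ^ r) ^ suc m ∎
    where
    open ≤-Reasoning
    X = tuples r

^-distribʳ-* : ∀ n a b → (a * b) ^ n ≡ a ^ n * b ^ n
^-distribʳ-* zero    a b = refl
^-distribʳ-* (suc n) a b = trans (cong (a * b *_) (^-distribʳ-* n a b)) ([m*n]*[o*p]≡[m*o]*[n*p] a b (a ^ n) (b ^ n))

-- The averaging argument.

module RandomTuples (s r k q : ℕ) (0<s : 0 < s) (0<q : 0 < q) where

  open Tuples q

  private instance
    s≢0 : NonZero s
    s≢0 = >-nonZero 0<s
    q≢0 : NonZero q
    q≢0 = >-nonZero 0<q

  X = tuples r
  N = length X

  -- A bound for the mean of `q ^ collisions T` over the lists of any fixed length at most `s`.
  Γ = (s ^ r) ^ s

  crowded : ℕ → List (Vec (Fin q) r) → ℕ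
  crowded m T = indicator (m * k ≤? collisions T)

  crowded-markov : ∀ m T → crowded m T * (q ^ k) ^ m ≤ q ^ collisions T
  crowded-markov m T with m * k ≤? collisions T
  ... | no  _ = z≤n
  ... | yes p = begin
    (q ^ k) ^ m + 0  ≡⟨ +-identityʳ _ ⟩
    (q ^ k) ^ m      ≡⟨ ^-*-assoc q k m ⟩
    q ^ (k * m)      ≡⟨ cong (q ^_) (*-comm k m) ⟩
    q ^ (m * k)      ≤⟨ ^-monoʳ-≤ q p ⟩
    q ^ collisions T ∎
    where open ≤-Reasoning

  -- Markov's inequality for `q ^ collisions T`, multiplied out: of the `N ^ suc m` lists at most
  -- the fraction `Γ / (q ^ k) ^ m` is crowded.
  ∑-crowded : ∀ m → suc m ≤ s → ∑ (words (suc m) X) (crowded m) * (q ^ k) ^ m ≤ Γ * N ^ suc m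
  ∑-crowded m m<s = begin
    ∑ (words (suc m) X) (crowded m) * (q ^ k) ^ m              ≡⟨ ∑-*ʳ (words (suc m) X) _ ⟨
    ∑ (words (suc m) X) (λ T → crowded m T * (q ^ k) ^ m)      ≤⟨ ∑-mono (words (suc m) X) (crowded-markov m) ⟩
    ∑ (words (suc m) X) (λ T → q ^ collisions T)               ≤⟨ collisions-generating r s (suc m) m<s ⟩
    ((s * q) ^ r) ^ suc m                                      ≡⟨ cong (_^ suc m) (^-distribʳ-* r s q) ⟩
    (s ^ r * q ^ r) ^ suc m                                    ≡⟨ ^-distribʳ-* (suc m) (s ^ r) (q ^ r) ⟩
    (s ^ r) ^ suc m * (q ^ r) ^ suc m                          ≤⟨ *-monoˡ-≤ _ (^-monoʳ-≤ (s ^ r) {{m^n≢0 s r}} m<s) ⟩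
    Γ * (q ^ r) ^ suc m                                        ≡⟨ cong (λ n → Γ * n ^ suc m) (length-tuples r) ⟨
    Γ * N ^ suc m                                              ∎
    where open ≤-Reasoning

  instance
    N≢0 : NonZero N
    N≢0 = subst NonZero (sym (length-tuples r)) (m^n≢0 q r)
    Γ≢0 : NonZero Γ
    Γ≢0 = m^n≢0 (s ^ r) s {{m^n≢0 s r}}

  -- The 6 is 3 times 2: three sizes are treated, and together they may cost at most half of the `M`
  -- letters.
  module _ (M : ℕ) {{M≢0 : NonZero M}} (M≤ : M * (6 * Γ) ≤ q ^ k) where

    total : ℕ → ℕ
    total m = ∑ (words M X) (occurrences (suc m) (crowded m))

    total-bound₁ : ∀ m → suc m ≤ s → total m * (q ^ k) ^ m ≤ M ^ suc m * Γ * N ^ M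
    total-bound₁ m m<s = *-cancelʳ-≤ _ _ (N ^ suc m) {{m^n≢0 N (suc m)}} (begin
      total m * (q ^ k) ^ m * N ^ suc m   ≡⟨ arith₁ (total m) ((q ^ k) ^ m) (N ^ suc m) ⟩
      total m * N ^ suc m * (q ^ k) ^ m   ≤⟨ *-monoˡ-≤ ((q ^ k) ^ m) (∑-occurrences X M (suc m) (crowded m)) ⟩
      M ^ suc m * K * N ^ M * (q ^ k) ^ m ≡⟨ arith₂ (M ^ suc m) K (N ^ M) ((q ^ k) ^ m) ⟩
      M ^ suc m * N ^ M * (K * (q ^ k) ^ m) ≤⟨ *-monoʳ-≤ (M ^ suc m * N ^ M) (∑-crowded m m<s) ⟩
      M ^ suc m * N ^ M * (Γ * N ^ suc m) ≡⟨ arith₃ (M ^ suc m) (N ^ M) Γ (N ^ suc m) ⟩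
      M ^ suc m * Γ * N ^ M * N ^ suc m   ∎)
      where
      open ≤-Reasoning
      K = ∑ (words (suc m) X) (crowded m)
      arith₁ : ∀ a b c → a * b * c ≡ a * c * b
      arith₁ = solve-∀
      arith₂ : ∀ a b c d → a * b * c * d ≡ a * c * (b * d)
      arith₂ = solve-∀
      arith₃ : ∀ a b c d → a * b * (c * d) ≡ a * c * b * d
      arith₃ = solve-∀

    -- Since the inner `m` is at least 1, `(q ^ k) ^ m` is at least `M ^ m * (6 * Γ)`, which leaves
    -- on average at most M / 6 crowded choices per word. A single tuple, the case of index 0, is
    -- always crowded.
    total-bound : ∀ m → suc (suc m) ≤ s → 6 * total (suc m) ≤ M * N ^ M
    total-bound m′ m<s = *-cancelʳ-≤ _ _ Γ (*-cancelʳ-≤ _ _ (M ^ m) {{m^n≢0 M m}} (begin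
      6 * total m * Γ * M ^ m           ≡⟨ arith₁ (total m) Γ (M ^ m) ⟩
      total m * (M ^ m * (6 * Γ))       ≡⟨ cong (λ z → total m * (M ^ m * z)) (*-identityʳ (6 * Γ)) ⟨
      total m * (M ^ m * (6 * Γ) ^ 1)   ≤⟨ *-monoʳ-≤ (total m) (*-monoʳ-≤ (M ^ m) (^-monoʳ-≤ (6 * Γ) {{m*n≢0 6 Γ}} (s≤s (z≤n {m′})))) ⟩
      total m * (M ^ m * (6 * Γ) ^ m)   ≡⟨ cong (total m *_) (^-distribʳ-* m M (6 * Γ)) ⟨
      total m * (M * (6 * Γ)) ^ m       ≤⟨ *-monoʳ-≤ (total m) (^-monoˡ-≤ m M≤) ⟩
      total m * (q ^ k) ^ m             ≤⟨ total-bound₁ m m<s ⟩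
      M ^ suc m * Γ * N ^ M             ≡⟨ arith₂ M (M ^ m) Γ (N ^ M) ⟩
      M * N ^ M * Γ * M ^ m             ∎))
      where
      open ≤-Reasoning
      m = suc m′
      arith₁ : ∀ a b c → 6 * a * b * c ≡ a * (c * (6 * b))
      arith₁ = solve-∀
      arith₂ : ∀ a b c d → a * b * c * d ≡ a * d * c * b
      arith₂ = solve-∀

    none⇒sparse : ∀ m {T} → occurrences (suc m) (crowded m) T ≡ 0 → Sparse k m T
    none⇒sparse m {T} none {U} U⊑T |U|
      with m * k ≤? collisions U
         | subst (λ l → crowded m U ≤ occurrences l (crowded m) T) |U| (≤-occurrences (crowded m) U⊑T)
    ... | yes _ | 1≤ = contradiction (≤-trans 1≤ (≤-reflexive none)) λ ()
    ... | no  p | _  = ≰⇒> p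

    count : ℕ → List (Vec (Fin q) r) → ℕ
    count m = occurrences (2 + m) (crowded (suc m))

    typical-word : ∀ a b c → 2 + a ≤ s → 2 + b ≤ s → 2 + c ≤ s →
      ∃[ w ] w ∈ˡ words M X × 2 * (count a w + count b w + count c w) ≤ M
    typical-word a b c a≤ b≤ c≤ = below-average (words M X) f nonempty-words ∑f≤
      where
      f : List (Vec (Fin q) r) → ℕ
      f w = 2 * (count a w + count b w + count c w)

      nonempty-words : 0 < length (words M X)
      nonempty-words = subst (0 <_) (sym (length-words M X)) (m^n>0 N M)

      ∑f≤ : ∑ (words M X) f ≤ length (words M X) * M
      -- Tripled so that each of the three totals appears with the factor 6 of `total-bound`.
      ∑f≤ = *-cancelˡ-≤ 3 (begin
        3 * ∑ (words M X) f
          ≡⟨ cong (3 *_) (trans (∑-*ˡ (words M X) 2) (cong (2 *_)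
               (trans (∑-+ (words M X)) (cong (_+ total (suc c)) (∑-+ (words M X)))))) ⟩
        3 * (2 * (total (suc a) + total (suc b) + total (suc c)))
          ≡⟨ arith₁ (total (suc a)) (total (suc b)) (total (suc c)) ⟩
        6 * total (suc a) + 6 * total (suc b) + 6 * total (suc c)
          ≤⟨ +-mono-≤ (+-mono-≤ (total-bound a a≤) (total-bound b b≤)) (total-bound c c≤) ⟩
        M * N ^ M + M * N ^ M + M * N ^ M
          ≡⟨ arith₂ M (N ^ M) ⟩
        3 * (N ^ M * M)
          ≡⟨ cong (λ z → 3 * (z * M)) (length-words M X) ⟨
        3 * (length (words M X) * M) ∎)
        where
        open ≤-Reasoning
        arith₁ : ∀ a b c → 3 * (2 * (a + b + c)) ≡ 6 * a + 6 * b + 6 * c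
        arith₁ = solve-∀
        arith₂ : ∀ m n → m * n + m * n + m * n ≡ 3 * (n * m)
        arith₂ = solve-∀

    -- The arguments are sizes less two: `a` stands for lists of `2 + a` tuples, and likewise `b`
    -- and `c`. Pruning a typical word loses at most half of its `M` letters.
    sparse-family : ∀ a b c → 2 + a ≤ s → 2 + b ≤ s → 2 + c ≤ s →
      ∃[ T ] M ≤ 2 * length T × Sparse k (suc a) T × Sparse k (suc b) T × Sparse k (suc c) T
    sparse-family a b c a≤ b≤ c≤ = sparsify (typical-word a b c a≤ b≤ c≤)
      where
      half : ∀ {l} t c → 2 * c ≤ M → l ≤ t + c → l ≡ M → M ≤ 2 * t
      half t c few l≤ refl = +-cancelʳ-≤ M M (2 * t) (begin
        M + M         ≡⟨ cong (M +_) (+-identityʳ M) ⟨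
        2 * M         ≤⟨ *-monoʳ-≤ 2 l≤ ⟩
        2 * (t + c)   ≡⟨ *-distribˡ-+ 2 t c ⟩
        2 * t + 2 * c ≤⟨ +-monoʳ-≤ (2 * t) few ⟩
        2 * t + M     ∎)
        where open ≤-Reasoning

      sparsify : ∃[ w ] w ∈ˡ words M X × 2 * (count a w + count b w + count c w) ≤ M →
        ∃[ T ] M ≤ 2 * length T × Sparse k (suc a) T × Sparse k (suc b) T × Sparse k (suc c) T
      sparsify (w , w∈ , few) = T , half (length T) (count a w + count b w + count c w) few (proj₂ (proj₂ (proj₂ pruned))) (∈-words⇒length M w∈)
        , (λ {U} → none⇒sparse (suc a) (proj₁ none) {U})
        , (λ {U} → none⇒sparse (suc b) (proj₁ (proj₂ none)) {U})
        , (λ {U} → none⇒sparse (suc c) (proj₂ (proj₂ none)) {U})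
        where
        pruned = prune₃ (suc a) (suc b) (suc c) (crowded (suc a)) (crowded (suc b)) (crowded (suc c)) w
        T      = proj₁ pruned
        none   = proj₁ (proj₂ (proj₂ pruned))

-- Tuples as edges of a hypergraph.

∣++∣ : ∀ {m n} (p : Subset m) (q : Subset n) → ∣ p Vec.++ q ∣ ≡ ∣ p ∣ + ∣ q ∣
∣++∣ []          q = refl
∣++∣ (true  ∷ p) q = cong suc (∣++∣ p q)
∣++∣ (false ∷ p) q = ∣++∣ p q

-- The vertex set [r] × [q] followed by p isolated vertices.
module Encoding (q p : ℕ) where

  order : ℕ → ℕ
  order zero    = p
  order (suc r) = q + order r

  order≡ : ∀ r → order r ≡ p + r * q
  order≡ zero    = sym (+-identityʳ p)
  order≡ (suc r) = trans (cong (q +_) (order≡ r)) (arith q p (r * q))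
    where
    arith : ∀ q p n → q + (p + n) ≡ p + (q + n)
    arith = solve-∀

  encode : ∀ {r} → Vec (Fin q) r → Subset (order r)
  encode []       = Subset.⊥
  encode (a ∷ as) = ⁅ a ⁆ Vec.++ encode as

  vertex : ∀ {r} → Fin r → Fin q → Fin (order r)
  vertex {suc r} zero    a = a ↑ˡ order r
  vertex         (suc i) a = q ↑ʳ vertex i a

  ∣encode∣ : ∀ {r} (x : Vec (Fin q) r) → ∣ encode x ∣ ≡ r
  ∣encode∣ []       = ∣⊥∣≡0 p
  ∣encode∣ (a ∷ as) = trans (∣++∣ ⁅ a ⁆ (encode as)) (cong₂ _+_ (∣⁅x⁆∣≡1 a) (∣encode∣ as))

  vertex∈encode : ∀ {r} (i : Fin r) x → vertex i (Vec.lookup x i) ∈ encode x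
  vertex∈encode zero    (a ∷ as) = Vec.lookup⇒[]= _ _ (trans (Vec.lookup-++ˡ ⁅ a ⁆ (encode as) a) (Vec.[]=⇒lookup (x∈⁅x⁆ a)))
  vertex∈encode (suc i) (a ∷ as) = Vec.lookup⇒[]= _ _ (trans (Vec.lookup-++ʳ ⁅ a ⁆ (encode as) _) (Vec.[]=⇒lookup (vertex∈encode i as)))

  vertex∈encode⇒≡ : ∀ {r} (i : Fin r) x {a} → vertex i a ∈ encode x → a ≡ Vec.lookup x i
  vertex∈encode⇒≡ zero    (b ∷ bs) {a} a∈ = x∈⁅y⁆⇒x≡y b
    (Vec.lookup⇒[]= _ _ (trans (sym (Vec.lookup-++ˡ ⁅ b ⁆ (encode bs) a)) (Vec.[]=⇒lookup a∈)))
  vertex∈encode⇒≡ (suc i) (b ∷ bs) {a} a∈ = vertex∈encode⇒≡ i bs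
    (Vec.lookup⇒[]= _ _ (trans (sym (Vec.lookup-++ʳ ⁅ b ⁆ (encode bs) (vertex i a))) (Vec.[]=⇒lookup a∈)))

  encode-injective : ∀ {r} {x y : Vec (Fin q) r} → encode x ≡ encode y → x ≡ y
  encode-injective {x = x} {y} eq = begin
    x                               ≡⟨ Vec.tabulate∘lookup x ⟨
    Vec.tabulate (Vec.lookup x)     ≡⟨ Vec.tabulate-cong (λ i → vertex∈encode⇒≡ i y (subst (_ ∈_) eq (vertex∈encode i x))) ⟩
    Vec.tabulate (Vec.lookup y)     ≡⟨ Vec.tabulate∘lookup y ⟩
    y                               ∎
    where open ≡-Reasoning

-- The s of the theorem is suc s here, and the u of the header 2 + u.
module SparseFamily (q p r k s u t : ℕ) (t+u≡ : t + (2 + u) ≡ suc (suc s))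
  (balance : r * (2 + u) ≡ (suc u + s) * k) (k≤r : k ≤ r) where

  open Tuples q
  open Encoding q p
  open DecMembership (_≟ₛ_ {order r}) using () renaming (_∈?_ to _∈ˡ?_)

  _≟ᵗ_ : DecidableEquality (Vec (Fin q) r)
  _≟ᵗ_ = Vec.≡-dec Fin._≟_

  -- A tuple listed twice would collide with itself in all `r ≥ k` coordinates. The words from which
  -- `T` is pruned may repeat letters.
  sparse⇒unique : ∀ {T} → Sparse {r} k 1 T → Unique T
  sparse⇒unique {[]}    sparse = []
  sparse⇒unique {x ∷ T} sparse =
    All.tabulate (λ { {y} y∈ refl → contradiction (sparse (refl ∷ from∈ y∈) refl) (≤⇒≯ (twice y)) })
    ∷ sparse⇒unique (λ U⊑T → sparse (x ∷ʳ U⊑T))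
    where
    twice : ∀ y → 1 * k ≤ collisions (y ∷ y ∷ [])
    twice y = begin
      1 * k                                  ≡⟨ +-identityʳ k ⟩
      k                                      ≤⟨ k≤r ⟩
      r                                      ≡⟨ trans (∑-const (allFin r) 1) (trans (*-identityʳ _) (length-allFin r)) ⟨
      ∑ (allFin r) (λ _ → 1)                 ≤⟨ ∑-mono (allFin r) (λ i → nonempty-length (repeats-here {xs = Vec.lookup y i ∷ []} (here refl))) ⟩
      collisions (y ∷ y ∷ [])                ∎
      where
      open ≤-Reasoning
      nonempty-length : ∀ {a} {as : List (Fin q)} → a ∈ˡ as → 1 ≤ length as
      nonempty-length (here _)  = s≤s z≤n
      nonempty-length (there _) = s≤s z≤n

  -- If no other tuple of `T` had the value of `x` at `i`, the vertex of `x` at `i` would be an own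
  -- vertex of `encode x`.
  unowned⇒repeats : ∀ {S T} {x : Vec (Fin q) r} i → x ∈ˡ T → S ⊆ map encode T → ¬ HasOwnVertex S (encode x) →
    Vec.lookup x i ∈ˡ repeats (column i T)
  unowned⇒repeats {S} {T} {x} i x∈T S⊆T unowned
    with any? (λ y → ¬? (x ≟ᵗ y) ×-dec (Vec.lookup x i Fin.≟ Vec.lookup y i)) T
  ... | yes found with y , y∈T , x≢y , eq ← find found = collision⇒repeats x∈T y∈T x≢y eq
  ... | no ¬found = contradiction
    (vertex i (Vec.lookup x i) , vertex∈encode i x , All.tabulate own) unowned
    where
    own : ∀ {f} → f ∈ˡ S → f ≢ encode x → vertex i (Vec.lookup x i) ∉ f
    own f∈S f≢ v∈f with y , y∈T , refl ← ∈-map⁻ encode (S⊆T f∈S) =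
      ¬found (lose y∈T ((λ x≡y → f≢ (cong encode (sym x≡y))) , vertex∈encode⇒≡ i y v∈f))

  sparse⇒thin : ∀ {T} → Unique T → Sparse {r} k (suc u) T → Sparse k s T → Thin (suc s) t (map encode T)
  sparse⇒thin {T} T! sparseᵤ sparseₛ S S! |S| S⊆E with t ≤? length (filter (hasOwnVertex? S) S)
  ... | yes enough = enough
  ... | no ¬enough = contradiction (sparseₛ T′⊑T |T′|) (≤⇒≯ crowded)
    where
    -- Sparsity speaks of sublists of `T`, while `S` may come in any order, so its tuples are listed
    -- again in the order of `T`.
    T′ = filter (λ x → encode x ∈ˡ? S) T

    T′⊑T : T′ ⊑ T
    T′⊑T = Sublist.filter-⊆ _ T

    T′⊆S : map encode T′ ⊆ S
    T′⊆S e∈ with x , x∈T′ , refl ← ∈-map⁻ encode e∈ = proj₂ (∈-filter⁻ (λ x → encode x ∈ˡ? S) {xs = T} x∈T′)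

    S⊆T′ : S ⊆ map encode T′
    S⊆T′ e∈S with x , x∈T , refl ← ∈-map⁻ encode (All.lookup S⊆E e∈S) =
      ∈-map⁺ encode (∈-filter⁺ (λ x → encode x ∈ˡ? S) x∈T e∈S)

    T′! : Unique T′
    T′! = Unique-resp-⊑ T′⊑T T!

    |T′| : length T′ ≡ suc s
    |T′| = trans (sym (length-map encode T′)) (trans (≤-antisym
      (Unique-⊆⇒length≤ (Unique.map⁺ encode-injective T′!) T′⊆S) (Unique-⊆⇒length≤ S! S⊆T′)) |S|)

    owned? : Decidable (λ x → HasOwnVertex S (encode x))
    owned? x = hasOwnVertex? S (encode x)

    few-owned : length (filter owned? T′) < t
    few-owned = ≤-<-trans (≤-trans (≤-reflexive (sym (length-map encode (filter owned? T′))))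
      (Unique-⊆⇒length≤ (Unique.map⁺ encode-injective (Unique.filter⁺ owned? T′!)) owned⊆)) (≰⇒> ¬enough)
      where
      owned⊆ : map encode (filter owned? T′) ⊆ filter (hasOwnVertex? S) S
      owned⊆ e∈ with x , x∈ , refl ← ∈-map⁻ encode e∈ with x∈T′ , own ← ∈-filter⁻ owned? {xs = T′} x∈ =
        ∈-filter⁺ (hasOwnVertex? S) (T′⊆S (∈-map⁺ encode x∈T′)) own

    unowned = filter (¬? ∘ owned?) T′

    many-unowned : 2 + u ≤ length unowned
    many-unowned = +-cancelˡ-≤ t _ _ (begin
      t + (2 + u)                                       ≡⟨ t+u≡ ⟩
      suc (suc s)                                       ≡⟨ cong suc |T′| ⟨
      suc (length T′)                                   ≡⟨ cong suc (length-filter-¬? owned? T′) ⟨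
      suc (length (filter owned? T′)) + length unowned  ≤⟨ +-monoˡ-≤ (length unowned) few-owned ⟩
      t + length unowned                                ∎)
      where open ≤-Reasoning

    -- Sparsity is available for exactly `2 + u` tuples, so surplus unowned ones are dropped.
    U = take (2 + u) unowned

    |U| : length U ≡ 2 + u
    |U| = trans (length-take (2 + u) unowned) (m≤n⇒m⊓n≡m many-unowned)

    U⊑unowned : U ⊑ unowned
    U⊑unowned = Sublist.take-⊆ (2 + u) unowned

    U⊑T : U ⊑ T
    U⊑T = ⊆-trans U⊑unowned (⊆-trans (Sublist.filter-⊆ _ T′) T′⊑T)

    -- No tuple of `U` owns a vertex, so its value at `i` is repeated in `T′`.
    per-coordinate : ∀ i → 2 + u ≤ rank (column i U) + rank (column i T′)
    per-coordinate i = ≤-trans (≤-reflexive (sym |U|)) (length≤rank+rank (λ x → Vec.lookup x i) U T′ λ x∈U →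
      case ∈-filter⁻ (¬? ∘ owned?) {xs = T′} (⊑-lookup U⊑unowned x∈U) of λ (x∈T′ , ¬own) →
        unowned⇒repeats i x∈T′ S⊆T′ ¬own)

    -- `collisions U` accounts for less than `suc u * k` of the total `(suc u + s) * k`, so at least
    -- `s * k` falls to `T′`.
    crowded : s * k ≤ collisions T′
    crowded = +-cancelˡ-≤ (suc u * k) _ _ (begin
      suc u * k + s * k                ≡⟨ *-distribʳ-+ k (suc u) s ⟨
      (suc u + s) * k                  ≡⟨ balance ⟨
      r * (2 + u)                      ≡⟨ trans (∑-const (allFin r) (2 + u)) (cong (_* (2 + u)) (length-allFin r)) ⟨
      ∑ (allFin r) (λ _ → 2 + u)       ≤⟨ ∑-mono (allFin r) per-coordinate ⟩
      ∑ (allFin r) (λ i → rank (column i U) + rank (column i T′)) ≡⟨ ∑-+ (allFin r) ⟩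
      collisions U + collisions T′     ≤⟨ +-monoˡ-≤ (collisions T′) (<⇒≤ (sparseᵤ U⊑T |U|)) ⟩
      suc u * k + collisions T′        ∎)
      where open ≤-Reasoning

-- The factor (2 r) ^ k pays for rounding n down to a multiple of r, and one
-- factor 2 for rounding q ^ k / A down.
blowup : ∀ f r k A → 0 < r → 0 < k → 0 < A →
  (∀ q p M → 0 < q → 0 < M → M * A ≤ q ^ k → M ≤ 2 * f (p + r * q)) → (λ n → n ^ k) ∈O f
blowup f r k A 0<r 0<k 0<A large = (2 * r) ^ k * (4 * A) , A * r , bound
  where
  instance
    r≢0 : NonZero r
    r≢0 = >-nonZero 0<r
    A≢0 : NonZero A
    A≢0 = >-nonZero 0<A

  bound : ∀ n → A * r ≤ n → n ^ k ≤ (2 * r) ^ k * (4 * A) * f n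
  bound n A*r≤n = begin
    n ^ k                                  ≤⟨ ^-monoˡ-≤ k n≤ ⟩
    (2 * r * q) ^ k                        ≡⟨ ^-distribʳ-* k (2 * r) q ⟩
    (2 * r) ^ k * q ^ k                    ≤⟨ *-monoʳ-≤ ((2 * r) ^ k) q^k≤ ⟩
    (2 * r) ^ k * (2 * M * A)              ≤⟨ *-monoʳ-≤ ((2 * r) ^ k) (*-monoˡ-≤ A (*-monoʳ-≤ 2 M≤)) ⟩
    (2 * r) ^ k * (2 * (2 * f n) * A)      ≡⟨ arith₁ ((2 * r) ^ k) (f n) A ⟩
    (2 * r) ^ k * (4 * A) * f n            ∎
    where
    open ≤-Reasoning
    q = n / r
    p = n % r
    M = q ^ k / A

    n≡ : n ≡ p + r * q
    n≡ = trans (m≡m%n+[m/n]*n n r) (cong (p +_) (*-comm q r))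

    -- This is what the threshold `A * r` for `n` is for; with `0 < k` it makes `q ^ k / A`
    -- positive, so that `large` applies.
    A≤q : A ≤ q
    A≤q = ≤-trans (≤-reflexive (sym (m*n/n≡m A r))) (/-monoˡ-≤ r A*r≤n)

    0<q : 0 < q
    0<q = ≤-trans 0<A A≤q

    A≤q^k : A ≤ q ^ k
    A≤q^k = ≤-trans A≤q (≤-trans (≤-reflexive (sym (^-identityʳ q))) (^-monoʳ-≤ q {{>-nonZero 0<q}} 0<k))

    0<M : 0 < M
    0<M = m≥n⇒m/n>0 A≤q^k

    M≤ : M ≤ 2 * f n
    M≤ = subst (λ n → M ≤ 2 * f n) (sym n≡) (large q p M 0<q 0<M (m/n*n≤m (q ^ k) A))

    n≤ : n ≤ 2 * r * q
    n≤ = begin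
      n             ≡⟨ n≡ ⟩
      p + r * q     ≤⟨ +-monoˡ-≤ (r * q) (≤-trans (<⇒≤ (m%n<n n r)) (m≤m*n r q {{>-nonZero 0<q}})) ⟩
      r * q + r * q ≡⟨ arith₂ r q ⟩
      2 * r * q     ∎
      where
      arith₂ : ∀ r q → r * q + r * q ≡ 2 * r * q
      arith₂ = solve-∀

    q^k≤ : q ^ k ≤ 2 * M * A
    q^k≤ = begin
      q ^ k               ≡⟨ m≡m%n+[m/n]*n (q ^ k) A ⟩
      q ^ k % A + M * A   ≤⟨ +-monoˡ-≤ (M * A) (≤-trans (<⇒≤ (m%n<n (q ^ k) A)) (m≤n*m A M {{>-nonZero 0<M}})) ⟩
      M * A + M * A       ≡⟨ arith₃ M A ⟩
      2 * M * A           ∎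
      where
      arith₃ : ∀ m a → m * a + m * a ≡ 2 * m * a
      arith₃ = solve-∀

    arith₁ : ∀ x y a → x * (2 * (2 * y) * a) ≡ x * (4 * a) * y
    arith₁ = solve-∀

-- Fitting the parameters together.

module Exponent (t h k d : ℕ) (0<t : 0 < t) (0<k : 0 < k) (balance : suc d * (2 + h) ≡ suc t + h + h) where

  -- Here `h` is s - t - 1, so u is `2 + h`, and `suc d` is the d of the theorem; `balance` says d u
  -- = 2 s - t - 1.
  s = suc t + h
  r = k * suc d

  -- The identity d u + 2 = s + u with one u moved across: a cluster with u covered edges has
  -- exactly `s` edges.
  rounds : 2 + (2 + h) * d ≡ s
  rounds = +-cancelˡ-≡ h _ _ (begin
    h + (2 + (2 + h) * d) ≡⟨ arith₁ h d ⟩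
    suc d * (2 + h)       ≡⟨ balance ⟩
    suc t + h + h         ≡⟨ +-comm (suc t + h) h ⟩
    h + s                 ∎)
    where
    open ≡-Reasoning
    arith₁ : ∀ h d → h + (2 + (2 + h) * d) ≡ suc d * (2 + h)
    arith₁ = solve-∀

  t+u≡ : t + (2 + h) ≡ suc s
  t+u≡ = trans (+-suc t (suc h)) (cong suc (+-suc t h))

  -- If `d` is 0, `rounds` gives `s = 2`, and then `0 < t` forces `h` to be 0.
  h≡0⊎0<d : h ≡ 0 ⊎ 0 < d
  h≡0⊎0<d = split d rounds
    where
    split : ∀ d → 2 + (2 + h) * d ≡ s → h ≡ 0 ⊎ 0 < d
    split (suc _) _  = inj₂ (s≤s z≤n)
    split zero    eq = inj₁ (n≤0⇒n≡0 (+-cancelˡ-≤ 2 h 0 (≤-trans (+-monoˡ-≤ h (s≤s 0<t))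
                         (≤-reflexive (trans (sym eq) (cong (2 +_) (*-zeroʳ h)))))))

  upper : (λ n → L s t n r) ∈O (λ n → n ^ k)
  upper = s , 0 , λ n _ → bound n
    where
    bound : ∀ n → L s t n r ≤ s * n ^ k
    bound n with H , thin , |H| ← L-attained {s} {t} (≤-trans (n≤1+n t) (m≤m+n (suc t) h)) n r =
      subst (_≤ s * n ^ k) |H| (Peeling.length≤s*n^k s t d k h h≡0⊎0<d rounds t+u≡ (distinct H)
        (All.map (λ {e} |e| → trans (length-vertices e) (trans |e| (*-comm k (suc d)))) (uniform H)) thin)

  finite-lower : ∀ q p M → 0 < q → 0 < M → M * (6 * (s ^ r) ^ s) ≤ q ^ k → M ≤ 2 * L s t (p + r * q) r
  finite-lower q p M 0<q 0<M M≤ = subst (λ n → M ≤ 2 * L s t n r) (order≡ r)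
    -- The three sizes 2, `2 + h` and `s`, each less two; `t + h` is positive, so the truncated
    -- subtraction is exact.
    (realise (sparse-family M {{>-nonZero 0<M}} M≤ 0 h (t + h ∸ 1) 2≤s 2+h≤s (≤-reflexive (cong suc 1+c≡))))
    where
    0<t+h : 0 < t + h
    0<t+h = ≤-trans 0<t (m≤m+n t h)

    1+c≡ : suc (t + h ∸ 1) ≡ t + h
    1+c≡ = m+[n∸m]≡n 0<t+h

    2≤s : 2 ≤ s
    2≤s = s≤s 0<t+h

    2+h≤s : 2 + h ≤ s
    2+h≤s = s≤s (+-monoˡ-≤ h 0<t)

    r*u≡ : r * (2 + h) ≡ (suc h + (t + h)) * k
    r*u≡ = trans (*-assoc k (suc d) (2 + h)) (trans (cong (k *_) balance) (arith k t h))
      where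
      arith : ∀ k t h → k * (suc t + h + h) ≡ (suc h + (t + h)) * k
      arith = solve-∀

    open RandomTuples s r k q (s≤s z≤n) 0<q using (sparse-family)
    open Tuples q using (Sparse)
    open Encoding q p
    open SparseFamily q p r k (t + h) h t t+u≡ r*u≡ (m≤m*n k (suc d))

    realise : ∃[ T ] M ≤ 2 * length T × Sparse {r} k 1 T × Sparse k (suc h) T × Sparse k (suc (t + h ∸ 1)) T →
      M ≤ 2 * L s t (order r) r
    realise (T , M≤2|T| , sparse₂ , sparseᵤ , sparseₛ) = ≤-trans M≤2|T| (*-monoʳ-≤ 2
      (subst (_≤ L s t (order r) r) (length-map encode T) (L-upper s t H thin)))
      where
      T! : Unique T
      T! = sparse⇒unique (λ {U} → sparse₂ {U})

      H : Hypergraph (order r) r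
      H = record
        { edges    = map encode T
        ; distinct = Unique.map⁺ encode-injective T!
        ; uniform  = All.map⁺ (All.tabulate λ {x} _ → ∣encode∣ x) }

      thin : IsThin s t H
      thin = sparse⇒thin T! (λ {U} → sparseᵤ {U}) (subst (λ m → Sparse k m T) 1+c≡ (λ {U} → sparseₛ {U}))

  lower : (λ n → n ^ k) ∈O (λ n → L s t n r)
  lower = blowup (λ n → L s t n r) r k (6 * (s ^ r) ^ s) 0<r 0<k
    (*-mono-≤ {1} {6} (s≤s z≤n) (m^n>0 (s ^ r) {{m^n≢0 s r}} s)) finite-lower
    where
    0<r : 0 < r
    0<r = ≤-trans 0<k (m≤m*n k (suc d))

corollary1p4 : (s t r d : ℕ) → 1 ≤ t → t < s → 2 ≤ r →
    d * (s ∸ t + 1) ≡ 2 * s ∸ t ∸ 1 →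
    (d∣r : d ∣ r) →
    ((λ n → L s t n r) ∈Θ (λ n → n ^ quotient d∣r)) ×
    (Σ[ D∣Nr ∈ (2 * s ∸ t ∸ 1) ∣ ((s ∸ t + 1) * r) ]
    ((λ n → L s t n r) ∈Θ (λ n → n ^ quotient D∣Nr)))
corollary1p4 s t r d 1≤t t<s 2≤r d*u≡ (divides k refl) with h , refl ← m≤n⇒∃[o]m+o≡n t<s =
  Θ , divides k divisible , Θ
  where
  u≡ : s ∸ t + 1 ≡ 2 + h
  u≡ = trans (cong (_+ 1) (trans (cong (_∸ t) (sym (+-suc t h))) (m+n∸m≡n t (suc h)))) (+-comm (suc h) 1)

  D≡ : 2 * s ∸ t ∸ 1 ≡ suc t + h + h
  D≡ = trans (∸-+-assoc (2 * s) t 1) (trans (cong (_∸ (t + 1)) (arith t h)) (m+n∸m≡n (t + 1) (suc t + h + h)))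
    where
    arith : ∀ t h → 2 * (suc t + h) ≡ t + 1 + (suc t + h + h)
    arith = solve-∀

  balance : d * (2 + h) ≡ suc t + h + h
  balance = trans (cong (d *_) (sym u≡)) (trans d*u≡ D≡)

  0<k : ∀ k → 2 ≤ k * d → 0 < k
  0<k (suc _) _ = s≤s z≤n

  -- For `d` equal to 0, `balance` would have 0 on the left and a successor on the right.
  Θ′ : ∀ d → d * (2 + h) ≡ suc t + h + h → (λ n → L s t n (k * d)) ∈Θ (λ n → n ^ k)
  Θ′ (suc d) balance = upper , lower
    where open Exponent t h k d 1≤t (0<k k 2≤r) balance

  Θ = Θ′ d balance

  -- The exponent (s - t + 1) r / (2 s - t - 1) is the same `k`, so one proof serves both claims.
  divisible : (s ∸ t + 1) * (k * d) ≡ k * (2 * s ∸ t ∸ 1)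
  divisible = trans (*-comm (s ∸ t + 1) (k * d)) (trans (*-assoc k d _) (cong (k *_) d*u≡))
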